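{- For every acyclic weighted digraph $D$ in which every arc has weight at least $1$, $\mathrm{mac}(D)\ge\frac{w(D)}{4}+\frac{w(D)^{0.6}}{24}$.
   Context: A weighted digraph $D=(V,A,w)$ is a digraph without loops or parallel arcs (opposite arcs allowed) with weights $w:A\to\mathbb{R}_{\ge0}$; $w(D)$ is the total arc weight. For a partition $(X,Y)$ of $V$, $w(X,Y)$ is the total weight of arcs from $X$ to $Y$, and $\mathrm{mac}(D)=\max_{(X,Y)}w(X,Y)$. Acyclic means containing no directed cycle. -}

module Defs where

open import Algebra.Bundles using (CommutativeRing)
open import Data.Bool.Base using (Bool; true; false; T; _∧_)
open import Data.Empty using (⊥-elim)
open import Data.Fin.Base using (Fin)
open import Data.Fin.Subset using (Subset; inside; outside; ∁)
open import Data.List.Base using (List; []; _∷_; [_]; _++_)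
open import Data.List.Relation.Unary.Linked using (Linked)
open import Data.List.Relation.Unary.Unique.Propositional using (Unique)
open import Data.Nat.Base as ℕ using (ℕ; zero; suc)
open import Data.Product.Base using (_×_; _,_; ∃-syntax; proj₁; proj₂)
open import Data.Rational.Base as ℚ using (ℚ; 0ℚ; 1ℚ)
import Data.Rational.Properties as ℚ
open import Data.Sum.Base using (_⊎_; inj₁; inj₂)
open import Data.Unit.Base using (tt)
open import Data.Vec.Base using ([]; _∷_; lookup)
open import Data.Vec.Functional as Vector using ()
open import Relation.Binary.PropositionalEquality
  using (_≡_; refl; sym; trans; cong; subst)
open import Relation.Nullary using (¬_)
open import Relation.Binary.Definitions using (tri<; tri≈; tri>)

open import Algebra.Properties.Semiring.Exp
  (CommutativeRing.semiring ℚ.+-*-commutativeRing) public using (_^_)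

-- Real numbers as Dedekind cuts, in the one-sided presentation (a cut is its
-- lower set): nonempty, bounded above, downward closed, without a greatest
-- element.  Locatedness is not required; it holds automatically in classical
-- logic, where these cuts are exactly the real numbers.

record ℝ : Set₁ where
  field
    lower     : ℚ → Set
    inhabited : ∃[ q ] lower q
    bounded   : ∃[ q ] ¬ lower q
    closed    : ∀ {p q} → p ℚ.< q → lower q → lower p
    rounded   : ∀ {p} → lower p → ∃[ q ] (p ℚ.< q × lower q)

open ℝ public

infix 4 _∈_ _≤_

_∈_ : ℚ → ℝ → Set
q ∈ x = lower x q

_≤_ : ℝ → ℝ → Set
x ≤ y = ∀ {q} → q ∈ x → q ∈ y

<⇒≱ : ∀ {p q} → p ℚ.< q → ¬ q ℚ.≤ p
<⇒≱ p<q q≤p = ℚ.<-irrefl refl (ℚ.<-≤-trans p<q q≤p)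

∈∧∉⇒< : ∀ x {p b} → p ∈ x → ¬ b ∈ x → p ℚ.< b
∈∧∉⇒< x {p} {b} p∈x b∉x with ℚ.<-cmp p b
... | tri< p<b _    _   = p<b
... | tri≈ _   refl _   = ⊥-elim (b∉x p∈x)
... | tri> _   _    b<p = ⊥-elim (b∉x (closed x b<p p∈x))

private
  p-1<p : ∀ p → p ℚ.- 1ℚ ℚ.< p
  p-1<p p = subst (p ℚ.- 1ℚ ℚ.<_) (ℚ.+-identityʳ p)
              (ℚ.+-monoʳ-< p (ℚ.negative⁻¹ (ℚ.- 1ℚ)))

  -+-cancel : ∀ p q → (p ℚ.- q) ℚ.+ q ≡ p
  -+-cancel p q = trans (ℚ.+-assoc p (ℚ.- q) q)
    (trans (cong (p ℚ.+_) (ℚ.+-inverseˡ q)) (ℚ.+-identityʳ p))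

  +--cancel : ∀ p q → (p ℚ.+ q) ℚ.- q ≡ p
  +--cancel p q = trans (ℚ.+-assoc p q (ℚ.- q))
    (trans (cong (p ℚ.+_) (ℚ.+-inverseʳ q)) (ℚ.+-identityʳ p))

fromℚ : ℚ → ℝ
fromℚ a = record
  { lower     = ℚ._< a
  ; inhabited = a ℚ.- 1ℚ , p-1<p a
  ; bounded   = a , ℚ.<-irrefl refl
  ; closed    = ℚ.<-trans
  ; rounded   = λ p<a → let (m , p<m , m<a) = ℚ.<-dense p<a in m , p<m , m<a
  }

0ℝ 1ℝ : ℝ
0ℝ = fromℚ 0ℚ
1ℝ = fromℚ 1ℚ

infixl 6 _+_
infixl 6 _⊔_
infixl 7 _÷_

_+_ : ℝ → ℝ → ℝ
x + y = record
  { lower     = λ q → ∃[ p ] ∃[ r ] (p ∈ x × r ∈ y × q ≡ p ℚ.+ r)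
  ; inhabited = let (p , p∈x) = inhabited x ; (r , r∈y) = inhabited y in
                p ℚ.+ r , p , r , p∈x , r∈y , refl
  ; bounded   = let (b , b∉x) = bounded x ; (c , c∉y) = bounded y in
                b ℚ.+ c , λ (p , r , p∈x , r∈y , eq) →
                  ℚ.<-irrefl (sym eq)
                    (ℚ.+-mono-< (∈∧∉⇒< x p∈x b∉x) (∈∧∉⇒< y r∈y c∉y))
  ; closed    = λ { {s} s<q (p , r , p∈x , r∈y , refl) →
                  s ℚ.- r , r
                  , closed x (subst (s ℚ.- r ℚ.<_) (+--cancel p r)
                               (ℚ.+-monoˡ-< (ℚ.- r) s<q)) p∈x
                  , r∈y , sym (-+-cancel s r) }
  ; rounded   = λ { (p , r , p∈x , r∈y , refl) →
                  let (p′ , p<p′ , p′∈x) = rounded x p∈x in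
                  p′ ℚ.+ r , ℚ.+-monoˡ-< r p<p′ , p′ , r , p′∈x , r∈y , refl }
  }

_⊔_ : ℝ → ℝ → ℝ
x ⊔ y = record
  { lower     = λ q → q ∈ x ⊎ q ∈ y
  ; inhabited = let (p , p∈x) = inhabited x in p , inj₁ p∈x
  ; bounded   = let (b , b∉x) = bounded x ; (c , c∉y) = bounded y in
                b ℚ.⊔ c , λ
                  { (inj₁ h) → <⇒≱ (∈∧∉⇒< x h b∉x) (ℚ.p≤p⊔q b c)
                  ; (inj₂ h) → <⇒≱ (∈∧∉⇒< y h c∉y) (ℚ.p≤q⊔p b c) }
  ; closed    = λ { p<q (inj₁ h) → inj₁ (closed x p<q h)
                  ; p<q (inj₂ h) → inj₂ (closed y p<q h) }
  ; rounded   = λ { (inj₁ h) → let (r , p<r , r∈x) = rounded x h in r , p<r , inj₁ r∈x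
                  ; (inj₂ h) → let (r , p<r , r∈y) = rounded y h in r , p<r , inj₂ r∈y }
  }

private
  module _ (k : ℚ) .{{k>0 : ℚ.Positive k}} where

    shrink : ℚ → ℚ
    shrink p = p ℚ.* (ℚ.1/ k) {{ℚ.pos⇒nonZero k}}

    shrink-* : ∀ p → shrink p ℚ.* k ≡ p
    shrink-* p = trans (ℚ.*-assoc p _ k)
      (trans (cong (p ℚ.*_) (ℚ.*-inverseˡ k {{ℚ.pos⇒nonZero k}})) (ℚ.*-identityʳ p))

_÷_ : ℝ → (k : ℚ) → .{{ℚ.Positive k}} → ℝ
x ÷ k = record
  { lower     = λ q → q ℚ.* k ∈ x
  ; inhabited = let (p , p∈x) = inhabited x in
                shrink k p , subst (_∈ x) (sym (shrink-* k p)) p∈x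
  ; bounded   = let (b , b∉x) = bounded x in
                shrink k b , λ h → b∉x (subst (_∈ x) (shrink-* k b) h)
  ; closed    = λ p<q → closed x (ℚ.*-monoˡ-<-pos k p<q)
  ; rounded   = λ {p} h → let (r , pk<r , r∈x) = rounded x h in
                shrink k r
                , ℚ.*-cancelʳ-<-nonNeg k {{ℚ.pos⇒nonNeg k}}
                    (subst (p ℚ.* k ℚ.<_) (sym (shrink-* k r)) pk<r)
                , subst (_∈ x) (sym (shrink-* k r)) r∈x
  }

private
  *-mono-≤-nonNeg : ∀ {p q r s} → 0ℚ ℚ.≤ r → 0ℚ ℚ.≤ q →
                    p ℚ.≤ q → r ℚ.≤ s → p ℚ.* r ℚ.≤ q ℚ.* s
  *-mono-≤-nonNeg {p} {q} {r} {s} 0≤r 0≤q p≤q r≤s = ℚ.≤-trans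
    (ℚ.*-monoʳ-≤-nonNeg r {{ℚ.nonNegative 0≤r}} p≤q)
    (ℚ.*-monoˡ-≤-nonNeg q {{ℚ.nonNegative 0≤q}} r≤s)

  0≤^ : ∀ {p} → 0ℚ ℚ.≤ p → ∀ m → 0ℚ ℚ.≤ p ^ m
  0≤^ 0≤p zero    = ℚ.nonNegative⁻¹ 1ℚ
  0≤^ {p} 0≤p (suc m) = subst (ℚ._≤ p ℚ.* p ^ m) (ℚ.*-zeroˡ 0ℚ)
    (*-mono-≤-nonNeg ℚ.≤-refl 0≤p 0≤p (0≤^ 0≤p m))

  ^-mono-≤ : ∀ {p q} → 0ℚ ℚ.≤ p → p ℚ.≤ q → ∀ m → p ^ m ℚ.≤ q ^ m
  ^-mono-≤ 0≤p p≤q zero    = ℚ.≤-refl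
  ^-mono-≤ 0≤p p≤q (suc m) = *-mono-≤-nonNeg (0≤^ 0≤p m)
    (ℚ.≤-trans 0≤p p≤q) p≤q (^-mono-≤ 0≤p p≤q m)

  0≤1 : 0ℚ ℚ.≤ 1ℚ
  0≤1 = ℚ.nonNegative⁻¹ 1ℚ

  1≤^ : ∀ {p} → 1ℚ ℚ.≤ p → ∀ m → 1ℚ ℚ.≤ p ^ m
  1≤^ 1≤p zero    = ℚ.≤-refl
  1≤^ {p} 1≤p (suc m) = subst (ℚ._≤ p ℚ.* p ^ m) (ℚ.*-identityˡ 1ℚ)
    (*-mono-≤-nonNeg 0≤1 (ℚ.≤-trans 0≤1 1≤p) 1≤p (1≤^ 1≤p m))

  p≤p^ : ∀ {p} → 1ℚ ℚ.≤ p → ∀ k .{{_ : ℕ.NonZero k}} → p ℚ.≤ p ^ k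
  p≤p^ {p} 1≤p (suc k) = subst (ℚ._≤ p ℚ.* p ^ k) (ℚ.*-identityʳ p)
    (*-mono-≤-nonNeg 0≤1 (ℚ.≤-trans 0≤1 1≤p) ℚ.≤-refl (1≤^ 1≤p k))

-- x ^[ m / k ] is x^(m/k) for real x ≥ 0 and m, k ≥ 1: the supremum of 0 and
-- of all rationals r ≥ 0 with r^k ≤ p^m for some rational 0 ≤ p < x.

_^[_/_] : ℝ → (m k : ℕ) → .{{ℕ.NonZero m}} → .{{ℕ.NonZero k}} → ℝ
x ^[ m / k ] = record
  { lower     = L
  ; inhabited = ℚ.- 1ℚ , inj₁ (ℚ.negative⁻¹ (ℚ.- 1ℚ))
  ; bounded   = B ^ m , unbounded
  ; closed    = λ { p<q (inj₁ q<0) → inj₁ (ℚ.<-trans p<q q<0)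
                  ; p<q (inj₂ (r , s , q<r , rest)) →
                      inj₂ (r , s , ℚ.<-trans p<q q<r , rest) }
  ; rounded   = λ { (inj₁ p<0) → let (q , p<q , q<0) = ℚ.<-dense p<0 in
                      q , p<q , inj₁ q<0
                  ; (inj₂ (r , s , p<r , rest)) →
                      let (q , p<q , q<r) = ℚ.<-dense p<r in
                      q , p<q , inj₂ (r , s , q<r , rest) }
  }
  where
  L : ℚ → Set
  L q = q ℚ.< 0ℚ ⊎ ∃[ r ] ∃[ p ]
    (q ℚ.< r × 0ℚ ℚ.≤ r × 0ℚ ℚ.≤ p × p ∈ x × r ^ k ℚ.≤ p ^ m)

  b B : ℚ
  b = proj₁ (bounded x)
  B = b ℚ.⊔ 1ℚ

  1≤B^m : 1ℚ ℚ.≤ B ^ m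
  1≤B^m = 1≤^ (ℚ.p≤q⊔p b 1ℚ) m

  unbounded : ¬ L (B ^ m)
  unbounded (inj₁ B^m<0) = <⇒≱ B^m<0 (ℚ.≤-trans 0≤1 1≤B^m)
  unbounded (inj₂ (r , p , B^m<r , _ , 0≤p , p∈x , r^k≤p^m)) =
    <⇒≱ B^m<r
      (ℚ.≤-trans (p≤p^ (ℚ.≤-trans 1≤B^m (ℚ.<⇒≤ B^m<r)) k)
        (ℚ.≤-trans r^k≤p^m (^-mono-≤ 0≤p p≤B m)))
    where
    p≤B : p ℚ.≤ B
    p≤B = ℚ.≤-trans (ℚ.<⇒≤ (∈∧∉⇒< x p∈x (proj₂ (bounded x)))) (ℚ.p≤p⊔q b 1ℚ)

∑ : ∀ {n} → (Fin n → ℝ) → ℝ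
∑ f = Vector.foldr _+_ 0ℝ f

maxSubset : ∀ {n} → (Subset n → ℝ) → ℝ
maxSubset {zero}  f = f []
maxSubset {suc n} f = maxSubset (λ S → f (outside ∷ S)) ⊔ maxSubset (λ S → f (inside ∷ S))

-- The vertex set is Fin n.  A Boolean adjacency function makes T (arc u v) a
-- proposition, so there is at most one arc from u to v.

record WeightedDigraph (n : ℕ) : Set₁ where
  field
    arc        : Fin n → Fin n → Bool
    loopless   : ∀ v → ¬ T (arc v v)
    weight     : ∀ u v → T (arc u v) → ℝ
    weight-≥0  : ∀ u v (a : T (arc u v)) → 0ℝ ≤ weight u v a

  Arc : Fin n → Fin n → Set
  Arc u v = T (arc u v)

  -- A cycle v → v₁ → … → vₖ → v through distinct vertices v, v₁, …, vₖ.
  record DirectedCycle : Set where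
    field
      base     : Fin n
      others   : List (Fin n)
      distinct : Unique (base ∷ others)
      linked   : Linked Arc (base ∷ others ++ [ base ])

  Acyclic : Set
  Acyclic = ¬ DirectedCycle

open WeightedDigraph public using (Arc; weight; Acyclic)

ifT : (b : Bool) → (T b → ℝ) → ℝ
ifT true  f = f tt
ifT false f = 0ℝ

module _ {n} (D : WeightedDigraph n) where
  open WeightedDigraph D using (arc)

  pairWeight : Fin n → Fin n → ℝ
  pairWeight u v = ifT (arc u v) (weight D u v)

  totalWeight : ℝ
  totalWeight = ∑ λ u → ∑ λ v → pairWeight u v

  weightBetween : Subset n → Subset n → ℝ
  weightBetween X Y = ∑ λ u → ∑ λ v →
    ifT (lookup X u ∧ lookup Y v) (λ _ → pairWeight u v)

  -- Partitions of the vertex set are the pairs (X , ∁ X).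
  mac : ℝ
  mac = maxSubset λ X → weightBetween X (∁ X)

{-# OPTIONS --safe #-}

-- For p : V → [0,1] let E p = Σ w(u,v) p(u) (1 - p(v)), the expected weight of
-- a cut with independent memberships; E is affine in each coordinate, so some
-- cut has weight at least E p, and E (½) = w(D)/4.  Suppose that all E p stay
-- below w(D)/4 + σ with 24 σ = s and s⁵ ≤ w(D)³.
-- * E (p + z) + E (p - z) = 2 E p - 2 Σ w(u,v) z(u) z(v), so moving along ± z
--   gains when z has opposite signs at the ends of arcs.  Taking for z the arcs
--   of a maximal matching, then stars from matched vertices to the remaining
--   (independent) ones, shows that at most 12 σ vertices are not isolated.
-- * Order the vertices topologically.  The arcs jumping over exactly ℓ
--   non-isolated vertices form disjoint paths, so their weight is at most 16 σ.
--   Hence the median length is large, and the sum Z of the weighted lengths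
--   satisfies w(D)² ≤ 64 σ Z.
-- * Z is the sum of the weights of the at most 12 σ cuts between initial and
--   final segments.  All arcs of such a cut C point the same way, so p = ½ ± ε
--   gains ε w(C) - ε² w(D), and a suitable ε contradicts s⁵ ≤ w(D)³.

module Submission where

module FractionalCuts where

  open import Algebra.Bundles using (CommutativeRing)
  open import Data.Bool.Base using (Bool; true; false; if_then_else_; T; _∧_; not)
  open import Data.Empty using (⊥-elim)
  open import Data.Fin.Base as Fin using (Fin; zero; suc; toℕ)
  import Data.Fin.Properties as Fin
  open import Data.Fin.Subset as Subset using (Subset; ∁; inside; outside; ∣_∣)
  import Data.Fin.Subset.Properties as Subset
  open import Data.Integer.Base as ℤ using (+≤+)
  open import Data.List.Base as List
    using (List; []; _∷_; [_]; _++_; length; allFin; cartesianProduct)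
  import Data.List.Membership.DecPropositional as DecMembership
  open import Data.List.Membership.Propositional using (_∈_)
  open import Data.List.Membership.Propositional.Properties
    using (∈-allFin; ∈-cartesianProduct⁺; ∈-∃++; ∈-++⁺ʳ; ∈-lookup)
  open import Data.List.Relation.Unary.All as All using ([]; _∷_)
  import Data.List.Relation.Unary.All.Properties as All
  open import Data.List.Relation.Unary.AllPairs using ([]; _∷_)
  open import Data.List.Relation.Unary.Any using (here; there)
  open import Data.List.Relation.Unary.Linked using (Linked; [-]; _∷_)
  open import Data.List.Relation.Unary.Unique.Propositional using (Unique)
  open import Data.Nat.Base as ℕ using (ℕ; zero; suc)
  import Data.Nat.Properties as ℕ
  open import Data.Product.Base using (_×_; _,_; ∃-syntax; proj₁; proj₂)
  open import Data.Rational.Base hiding (∣_∣; truncate)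
  open import Data.Rational.Properties
  open import Data.Sum.Base using (_⊎_; inj₁; inj₂; [_,_]′)
  open import Data.Vec.Base as Vec using ([]; _∷_; lookup; tabulate)
  import Data.Vec.Functional as Vector
  open import Data.Vec.Properties using (lookup∘tabulate; lookup-map; lookup⇒[]=; []=⇒lookup)
  open import Function.Base using (_∘_; case_of_)
  open import Function.Definitions using (Injective)
  open import Induction.WellFounded using (Acc; acc; WellFounded)
  open import Relation.Binary.Definitions using (tri<; tri≈; tri>)
  open import Relation.Binary.PropositionalEquality hiding ([_])
  open import Relation.Nullary
  open import Relation.Nullary.Decidable as Dec using (_×-dec_; dec-true)
  open import Tactic.RingSolver using (solve-∀)
  open import Tactic.RingSolver.Core.AlmostCommutativeRing
    using (AlmostCommutativeRing; fromCommutativeRing)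
  open import Algebra.Properties.Semiring.Sum
    (CommutativeRing.semiring +-*-commutativeRing)
    using (sum; sum-cong-≗; ∑-distrib-+; ∑-comm; *-distribˡ-sum; *-distribʳ-sum)
  import Defs as ℝ

  -- Rational arithmetic and indicators of decidable propositions

  ring : AlmostCommutativeRing _ _
  ring = fromCommutativeRing +-*-commutativeRing λ x → Dec.dec⇒maybe (0ℚ ≟ x)

  ¼ ⅛ 4ℚ 6ℚ 12ℚ 16ℚ 18ℚ 24ℚ 32ℚ 64ℚ : ℚ
  ¼ = ℤ.+ 1 / 4
  ⅛ = ℤ.+ 1 / 8
  4ℚ = ℤ.+ 4 / 1
  6ℚ = ℤ.+ 6 / 1
  12ℚ = ℤ.+ 12 / 1
  16ℚ = ℤ.+ 16 / 1
  18ℚ = ℤ.+ 18 / 1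
  24ℚ = ℤ.+ 24 / 1
  32ℚ = ℤ.+ 32 / 1
  64ℚ = ℤ.+ 64 / 1

  0≤1 : 0ℚ ≤ 1ℚ
  0≤1 = nonNegative⁻¹ 1ℚ

  0≤½ : 0ℚ ≤ ½
  0≤½ = nonNegative⁻¹ ½

  0≤¼ : 0ℚ ≤ ¼
  0≤¼ = nonNegative⁻¹ ¼

  infixl 6 _⊞_
  infixl 7 _⊠_

  _⊞_ : ∀ {p q} → 0ℚ ≤ p → 0ℚ ≤ q → 0ℚ ≤ p + q
  _⊞_ = +-mono-≤

  _⊠_ : ∀ {p q} → 0ℚ ≤ p → 0ℚ ≤ q → 0ℚ ≤ p * q
  _⊠_ {p} {q} 0≤p 0≤q = subst (_≤ p * q) (*-zeroˡ q)
    (*-monoʳ-≤-nonNeg q {{nonNegative 0≤q}} 0≤p)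

  p≡0⇒p*q≡0 : ∀ {p} q → p ≡ 0ℚ → p * q ≡ 0ℚ
  p≡0⇒p*q≡0 q refl = *-zeroˡ q

  q≡0⇒p*q≡0 : ∀ p {q} → q ≡ 0ℚ → p * q ≡ 0ℚ
  q≡0⇒p*q≡0 p refl = *-zeroʳ p

  ≤⇒0≤ : ∀ {p q} → p ≤ q → 0ℚ ≤ q - p
  ≤⇒0≤ {p} {q} p≤q = subst (_≤ q - p) (+-inverseʳ p) (+-monoˡ-≤ (- p) p≤q)

  -- An inequality from a certificate: a nonnegative quantity equal to its slack.
  ≤-cert : ∀ {p q d} → 0ℚ ≤ d → q ≡ p + d → p ≤ q
  ≤-cert {p} {q} {d} 0≤d q≡p+d = subst₂ _≤_ (+-identityʳ p) (sym q≡p+d) (+-monoʳ-≤ p 0≤d)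

  1≤⇒≢0 : ∀ {p} → 1ℚ ≤ p → p ≢ 0ℚ
  1≤⇒≢0 (*≤* (+≤+ ())) refl

  +-cancelˡ-< : ∀ p {q r} → p + q < p + r → q < r
  +-cancelˡ-< p p+q<p+r = ≰⇒> λ r≤q → <-irrefl refl (<-≤-trans p+q<p+r (+-monoʳ-≤ p r≤q))

  *-cancelʳ-≤ : ∀ {p q r} → 0ℚ < r → p * r ≤ q * r → p ≤ q
  *-cancelʳ-≤ {r = r} 0<r = *-cancelʳ-≤-pos r {{positive 0<r}}

  𝟙 : ∀ {a} {A : Set a} → Dec A → ℚ
  𝟙 d = if does d then 1ℚ else 0ℚ

  𝟙-yes : ∀ {a} {A : Set a} (d : Dec A) → A → 𝟙 d ≡ 1ℚ
  𝟙-yes (yes _) _ = refl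
  𝟙-yes (no ¬a) a = ⊥-elim (¬a a)

  𝟙-no : ∀ {a} {A : Set a} (d : Dec A) → ¬ A → 𝟙 d ≡ 0ℚ
  𝟙-no (yes a) ¬a = ⊥-elim (¬a a)
  𝟙-no (no _)  _  = refl

  0≤𝟙 : ∀ {a} {A : Set a} (d : Dec A) → 0ℚ ≤ 𝟙 d
  0≤𝟙 (yes _) = 0≤1
  0≤𝟙 (no _)  = ≤-refl

  𝟙≤1 : ∀ {a} {A : Set a} (d : Dec A) → 𝟙 d ≤ 1ℚ
  𝟙≤1 (yes _) = ≤-refl
  𝟙≤1 (no _)  = 0≤1

  -- Finite sums

  sum-mono-≤ : ∀ {n} {f g : Fin n → ℚ} → (∀ i → f i ≤ g i) → sum f ≤ sum g
  sum-mono-≤ {zero}  f≤g = ≤-refl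
  sum-mono-≤ {suc _} f≤g = +-mono-≤ (f≤g zero) (sum-mono-≤ (f≤g ∘ suc))

  sum-zero : ∀ {n} {f : Fin n → ℚ} → (∀ i → f i ≡ 0ℚ) → sum f ≡ 0ℚ
  sum-zero {zero}  f≡0 = refl
  sum-zero {suc _} f≡0 = cong₂ _+_ (f≡0 zero) (sum-zero (f≡0 ∘ suc))

  0≤sum : ∀ {n} {f : Fin n → ℚ} → (∀ i → 0ℚ ≤ f i) → 0ℚ ≤ sum f
  0≤sum {zero}  0≤f = ≤-refl
  0≤sum {suc _} 0≤f = 0≤f zero ⊞ 0≤sum (0≤f ∘ suc)

  δ : ∀ {n} → Fin n → Fin n → ℚ
  δ k v = 𝟙 (k Fin.≟ v)

  sum-δ : ∀ {n} (k : Fin n) (f : Fin n → ℚ) → sum (λ v → δ k v * f v) ≡ f k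
  sum-δ zero f = trans
    (cong₂ _+_ (*-identityˡ (f zero)) (sum-zero λ v → *-zeroˡ (f (suc v))))
    (+-identityʳ (f zero))
  sum-δ (suc k) f = trans
    (cong₂ _+_ (*-zeroˡ (f zero)) (sum-δ k (f ∘ suc)))
    (+-identityˡ (f (suc k)))

  δ-sym : ∀ {n} (k v : Fin n) → δ k v ≡ δ v k
  δ-sym k v with k Fin.≟ v
  ... | yes refl = sym (𝟙-yes (k Fin.≟ k) refl)
  ... | no  k≢v  = sym (𝟙-no (v Fin.≟ k) (k≢v ∘ sym))

  sum-𝟙≤1 : ∀ {n} {P : Fin n → Set} (P? : ∀ v → Dec (P v)) →
            (∀ {u v} → P u → P v → u ≡ v) → sum (λ v → 𝟙 (P? v)) ≤ 1ℚ
  sum-𝟙≤1 P? unique with Fin.any? P?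
  ... | no ∄P = subst (_≤ 1ℚ) (sym (sum-zero λ v → 𝟙-no (P? v) (∄P ∘ (v ,_)))) 0≤1
  ... | yes (k , Pk) = subst (sum (λ v → 𝟙 (P? v)) ≤_) (sum-δ k λ _ → 1ℚ) (sum-mono-≤ 𝟙≤δ)
    where
    𝟙≤δ : ∀ v → 𝟙 (P? v) ≤ δ k v * 1ℚ
    𝟙≤δ v with P? v
    ... | no _   = 0≤𝟙 (k Fin.≟ v) ⊠ 0≤1
    ... | yes Pv = ≤-reflexive (sym (cong (_* 1ℚ) (𝟙-yes (k Fin.≟ v) (unique Pk Pv))))

  sum₂ : ∀ {m n} → (Fin m → Fin n → ℚ) → ℚ
  sum₂ f = sum λ u → sum (f u)

  module _ {m n : ℕ} where

    private variable f g : Fin m → Fin n → ℚ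

    sum₂-cong : (∀ u v → f u v ≡ g u v) → sum₂ f ≡ sum₂ g
    sum₂-cong f≡g = sum-cong-≗ λ u → sum-cong-≗ (f≡g u)

    sum₂-mono-≤ : (∀ u v → f u v ≤ g u v) → sum₂ f ≤ sum₂ g
    sum₂-mono-≤ f≤g = sum-mono-≤ λ u → sum-mono-≤ (f≤g u)

    0≤sum₂ : (∀ u v → 0ℚ ≤ f u v) → 0ℚ ≤ sum₂ f
    0≤sum₂ 0≤f = 0≤sum λ u → 0≤sum (0≤f u)

    sum₂-zero : (∀ u v → f u v ≡ 0ℚ) → sum₂ f ≡ 0ℚ
    sum₂-zero f≡0 = sum-zero λ u → sum-zero (f≡0 u)

    sum₂-+ : ∀ (f g : Fin m → Fin n → ℚ) → sum₂ (λ u v → f u v + g u v) ≡ sum₂ f + sum₂ g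
    sum₂-+ f g = trans (sum-cong-≗ λ u → ∑-distrib-+ (f u) (g u))
      (∑-distrib-+ (sum ∘ f) (sum ∘ g))

    *-distribˡ-sum₂ : ∀ c (f : Fin m → Fin n → ℚ) → c * sum₂ f ≡ sum₂ λ u v → c * f u v
    *-distribˡ-sum₂ c f = trans (*-distribˡ-sum c (sum ∘ f))
      (sum-cong-≗ λ u → *-distribˡ-sum c (f u))

    sum-sum₂ : ∀ {l} (h : Fin l → Fin m → Fin n → ℚ) →
               sum (λ k → sum₂ (h k)) ≡ sum₂ λ u v → sum λ k → h k u v
    sum-sum₂ h = trans (∑-comm λ k u → sum (h k u))
      (sum-cong-≗ λ u → ∑-comm λ k → h k u)

  -- Fractional cuts

  module Cut {n : ℕ} (w : Fin n → Fin n → ℚ) where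

    W : ℚ
    W = sum₂ w

    -- The expected weight of the cut (X , V ∖ X) when each vertex v lies in X
    -- independently with probability p v.
    E : (Fin n → ℚ) → ℚ
    E p = sum₂ λ u v → w u v * (p u * (1ℚ - p v))

    -- `- Q z` is the quadratic term in `z` of `E` at a point shifted by `z`.
    Q : (Fin n → ℚ) → ℚ
    Q z = sum₂ λ u v → w u v * (z u * z v)

    E-cong : ∀ {p q} → (∀ v → p v ≡ q v) → E p ≡ E q
    E-cong p≗q = sum₂-cong λ u v → cong (w u v *_) (cong₂ (λ x y → x * (1ℚ - y)) (p≗q u) (p≗q v))

    parallelogram : ∀ p z → E (λ v → p v + z v) + E (λ v → p v - z v) + (Q z + Q z) ≡ E p + E p
    parallelogram p z =
      trans (cong₂ _+_ (sym (sum₂-+ a b)) (sym (sum₂-+ q q)))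
        (trans (sym (sum₂-+ (λ u v → a u v + b u v) (λ u v → q u v + q u v)))
          (trans (sum₂-cong λ u v → eq (w u v) (p u) (p v) (z u) (z v)) (sum₂-+ e e)))
      where
      a b q e : Fin n → Fin n → ℚ
      a u v = w u v * ((p u + z u) * (1ℚ - (p v + z v)))
      b u v = w u v * ((p u - z u) * (1ℚ - (p v - z v)))
      q u v = w u v * (z u * z v)
      e u v = w u v * (p u * (1ℚ - p v))

      eq : ∀ w p q s t → w * ((p + s) * (1ℚ - (q + t))) + w * ((p - s) * (1ℚ - (q - t)))
           + (w * (s * t) + w * (s * t)) ≡ w * (p * (1ℚ - q)) + w * (p * (1ℚ - q))
      eq = solve-∀ ring

    -- The move must be available from every `p`, even outside the unit cube, so that gains can be
    -- chained; only the total radius is compared with `½` at the end.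
    Gain : (Fin n → ℚ) → ℚ → Set
    Gain r γ = ∀ p → ∃[ p′ ]
      ((∀ v → p′ v ≤ p v + r v) × (∀ v → p v ≤ p′ v + r v) × E p + γ ≤ E p′)

    gain-0 : Gain (λ _ → 0ℚ) 0ℚ
    gain-0 p = p , p≤p+0 , p≤p+0 , ≤-reflexive (+-identityʳ (E p))
      where
      p≤p+0 : ∀ v → p v ≤ p v + 0ℚ
      p≤p+0 v = ≤-reflexive (sym (+-identityʳ (p v)))

    gain-mono : ∀ {r s γ β} → (∀ v → r v ≤ s v) → β ≤ γ → Gain r γ → Gain s β
    gain-mono r≤s β≤γ gain p with p′ , p′≤ , p≤ , up ← gain p =
      p′ , (λ v → ≤-trans (p′≤ v) (+-monoʳ-≤ (p v) (r≤s v)))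
         , (λ v → ≤-trans (p≤ v) (+-monoʳ-≤ (p′ v) (r≤s v)))
         , ≤-trans (+-monoʳ-≤ (E p) β≤γ) up

    gain-+ : ∀ {r s γ β} → Gain r γ → Gain s β → Gain (λ v → r v + s v) (γ + β)
    gain-+ {r} {s} {γ} {β} gain₁ gain₂ p
      with p′ , p′≤ , p≤ , up₁ ← gain₁ p
      with p″ , p″≤ , p′≤″ , up₂ ← gain₂ p′ =
      p″ , (λ v → ≤-trans (p″≤ v) (≤-trans (+-monoˡ-≤ (s v) (p′≤ v)) (≤-reflexive (+-assoc (p v) (r v) (s v)))))
         , (λ v → ≤-trans (p≤ v) (≤-trans (+-monoˡ-≤ (r v) (p′≤″ v)) (≤-reflexive (swap (p″ v) (r v) (s v)))))
         , ≤-trans (≤-reflexive (sym (+-assoc (E p) γ β))) (≤-trans (+-monoˡ-≤ β up₁) up₂)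
      where
      swap : ∀ x r s → x + s + r ≡ x + (r + s)
      swap = solve-∀ ring

    gain-sum : ∀ {m} {r : Fin m → Fin n → ℚ} {γ : Fin m → ℚ} →
               (∀ k → Gain (r k) (γ k)) → Gain (λ v → sum λ k → r k v) (sum γ)
    gain-sum {zero}  gain = gain-0
    gain-sum {suc _} gain = gain-+ (gain zero) (gain-sum (gain ∘ suc))

    -- By the parallelogram identity one of the moves ± z raises E by - Q z.
    gain-± : ∀ z {r γ} → (∀ v → z v ≤ r v) → (∀ v → - z v ≤ r v) → γ + Q z ≤ 0ℚ → Gain r γ
    gain-± z {r} {γ} z≤r -z≤r γ+Q≤0 p with E p + γ ≤? E (λ v → p v + z v)
    ... | yes up = (λ v → p v + z v) , (λ v → +-monoʳ-≤ (p v) (z≤r v))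
        , (λ v → ≤-cert (≤⇒0≤ (-z≤r v)) (eq (p v) (z v) (r v))) , up
      where
      eq : ∀ p z r → p + z + r ≡ p + (r - - z)
      eq = solve-∀ ring
    -- `E (p - z)` equals `2 E p - E (p + z) - 2 Q z`; here `E (p + z)` is below `E p + γ` and
    -- `- Q z` is at least `γ`.
    ... | no ¬up = (λ v → p v - z v) , (λ v → +-monoʳ-≤ (p v) (-z≤r v))
        , (λ v → ≤-cert (≤⇒0≤ (z≤r v)) (eq (p v) (z v) (r v)))
        , ≤-cert (≤⇒0≤ (<⇒≤ (≰⇒> ¬up)) ⊞ (≤⇒0≤ γ+Q≤0 ⊞ ≤⇒0≤ γ+Q≤0))
            (trans (eq₁ (E (λ v → p v - z v)) (E (λ v → p v + z v)) (Q z))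
              (trans (cong (_- (E (λ v → p v + z v) + (Q z + Q z))) (parallelogram p z))
                (eq₂ (E p) (E (λ v → p v + z v)) (Q z) γ)))
      where
      eq : ∀ p z r → p - z + r ≡ p + (r - z)
      eq = solve-∀ ring
      eq₁ : ∀ a b q → a ≡ b + a + (q + q) - (b + (q + q))
      eq₁ = solve-∀ ring
      eq₂ : ∀ e b q γ → e + e - (b + (q + q)) ≡
            e + γ + (e + γ - b + (0ℚ - (γ + q) + (0ℚ - (γ + q))))
      eq₂ = solve-∀ ring

  indicator : ∀ {n} → Subset n → Fin n → ℚ
  indicator X v = if lookup X v then 1ℚ else 0ℚ

  IsProbability : ℚ → Set
  IsProbability x = 0ℚ ≤ x × x ≤ 1ℚ

  -- Rounding

  module _ {n : ℕ} (w : Fin n → Fin n → ℚ) (loopless : ∀ v → w v v ≡ 0ℚ) where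
    open Cut w

    infixl 5 _[_]≔_

    _[_]≔_ : (Fin n → ℚ) → Fin n → ℚ → Fin n → ℚ
    (p [ i ]≔ x) v = if does (i Fin.≟ v) then x else p v

    -- Loops have weight zero, so no surviving term contains `p i` twice.
    E-affine : ∀ p i → E p ≡ p i * E (p [ i ]≔ 1ℚ) + (1ℚ - p i) * E (p [ i ]≔ 0ℚ)
    E-affine p i = sym
      (trans (cong₂ _+_ (*-distribˡ-sum₂ (p i) (e 1ℚ)) (*-distribˡ-sum₂ (1ℚ - p i) (e 0ℚ)))
        (trans (sym (sum₂-+ (λ u v → p i * e 1ℚ u v) (λ u v → (1ℚ - p i) * e 0ℚ u v)))
          (sum₂-cong pointwise)))
      where
      e : ℚ → Fin n → Fin n → ℚ
      e x u v = w u v * ((p [ i ]≔ x) u * (1ℚ - (p [ i ]≔ x) v))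

      none : ∀ w x p q → x * (w * (p * (1ℚ - q))) + (1ℚ - x) * (w * (p * (1ℚ - q))) ≡ w * (p * (1ℚ - q))
      none = solve-∀ ring
      tail : ∀ w x q → x * (w * (1ℚ * (1ℚ - q))) + (1ℚ - x) * (w * (0ℚ * (1ℚ - q))) ≡ w * (x * (1ℚ - q))
      tail = solve-∀ ring
      head : ∀ w x p → x * (w * (p * (1ℚ - 1ℚ))) + (1ℚ - x) * (w * (p * (1ℚ - 0ℚ))) ≡ w * (p * (1ℚ - x))
      head = solve-∀ ring
      loop : ∀ x → x * (0ℚ * (1ℚ * (1ℚ - 1ℚ))) + (1ℚ - x) * (0ℚ * (0ℚ * (1ℚ - 0ℚ))) ≡ 0ℚ * (x * (1ℚ - x))
      loop = solve-∀ ring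

      pointwise : ∀ u v → p i * e 1ℚ u v + (1ℚ - p i) * e 0ℚ u v ≡ w u v * (p u * (1ℚ - p v))
      pointwise u v with i Fin.≟ u | i Fin.≟ v
      ... | yes refl | yes refl rewrite loopless i = loop (p i)
      ... | yes refl | no _     = tail (w i v) (p i) (p v)
      ... | no _     | yes refl = head (w u i) (p i) (p u)
      ... | no _     | no _     = none (w u v) (p i) (p u) (p v)

    IsBit : ℚ → Set
    IsBit x = x ≡ 0ℚ ⊎ x ≡ 1ℚ

    bit-prob : ∀ {x} → IsBit x → IsProbability x
    bit-prob (inj₁ refl) = ≤-refl , 0≤1
    bit-prob (inj₂ refl) = 0≤1 , ≤-refl

    -- By `E-affine`, `E p` is a convex combination of the two end values, hence at most the larger
    -- one.
    round-one : ∀ p → (∀ v → IsProbability (p v)) → ∀ i →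
                ∃[ x ] (IsBit x × E p ≤ E (p [ i ]≔ x))
    round-one p prob i with ≤-total (E (p [ i ]≔ 0ℚ)) (E (p [ i ]≔ 1ℚ))
    ... | inj₁ E₀≤E₁ = 1ℚ , inj₂ refl ,
      ≤-cert (≤⇒0≤ (proj₂ (prob i)) ⊠ ≤⇒0≤ E₀≤E₁)
        (trans (eq (p i) (E (p [ i ]≔ 1ℚ)) (E (p [ i ]≔ 0ℚ)))
          (cong (_+ (1ℚ - p i) * (E (p [ i ]≔ 1ℚ) - E (p [ i ]≔ 0ℚ))) (sym (E-affine p i))))
      where
      eq : ∀ x a b → a ≡ x * a + (1ℚ - x) * b + (1ℚ - x) * (a - b)
      eq = solve-∀ ring
    ... | inj₂ E₁≤E₀ = 0ℚ , inj₁ refl ,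
      ≤-cert (proj₁ (prob i) ⊠ ≤⇒0≤ E₁≤E₀)
        (trans (eq (p i) (E (p [ i ]≔ 1ℚ)) (E (p [ i ]≔ 0ℚ)))
          (cong (_+ p i * (E (p [ i ]≔ 0ℚ) - E (p [ i ]≔ 1ℚ))) (sym (E-affine p i))))
      where
      eq : ∀ x a b → b ≡ x * a + (1ℚ - x) * b + x * (b - a)
      eq = solve-∀ ring

    module _ (p : Fin n → ℚ) (prob : ∀ v → IsProbability (p v)) where

      round-many : ∀ vs → ∃[ q ]
        ((∀ v → IsProbability (q v)) × (∀ {v} → v ∈ vs → IsBit (q v)) × E p ≤ E q)
      round-many [] = p , prob , (λ ()) , ≤-refl
      round-many (i ∷ vs)
        with q , prob-q , bits , up ← round-many vs
        with x , bit , up′ ← round-one q prob-q i =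
        (q [ i ]≔ x) , prob′ , bits′ , ≤-trans up up′
        where
        prob′ : ∀ v → IsProbability ((q [ i ]≔ x) v)
        prob′ v with does (i Fin.≟ v)
        ... | true  = bit-prob bit
        ... | false = prob-q v

        bits′ : ∀ {v} → v ∈ i ∷ vs → IsBit ((q [ i ]≔ x) v)
        bits′ {v} v∈ with i Fin.≟ v | v∈
        ... | yes _   | _           = bit
        ... | no i≢v  | here v≡i    = ⊥-elim (i≢v (sym v≡i))
        ... | no _    | there v∈vs  = bits v∈vs

      rounding : ∃[ X ] E p ≤ E (indicator X)
      rounding with q , _ , bits , up ← round-many (allFin n) =
        X , ≤-trans up (≤-reflexive (E-cong q≗X))
        where
        X : Subset n
        X = tabulate λ v → does (q v ≟ 1ℚ)

        q≗X : ∀ v → q v ≡ indicator X v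
        q≗X v rewrite lookup∘tabulate (λ v → does (q v ≟ 1ℚ)) v
          with q v ≟ 1ℚ | bits (∈-allFin v)
        ... | yes q≡1 | _        = q≡1
        ... | no _    | inj₁ q≡0 = q≡0
        ... | no q≢1  | inj₂ q≡1 = ⊥-elim (q≢1 q≡1)

  -- Stars

    loop≡0 : ∀ k u v → w u v * (δ k u * δ k v) ≡ 0ℚ
    loop≡0 k u v with k Fin.≟ u | k Fin.≟ v
    ... | yes refl | yes refl = trans (cong (_* (1ℚ * 1ℚ)) (loopless k)) (*-zeroˡ (1ℚ * 1ℚ))
    ... | yes _    | no _     = *-zeroʳ (w u v)
    ... | no _     | yes _    = *-zeroʳ (w u v)
    ... | no _     | no _     = *-zeroʳ (w u v)

    -- The move is `α` at the centre against `l` on the leaves, with opposite signs. In `Q` the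
    -- square at `k` vanishes for want of a loop and the products of leaves by independence, so only
    -- the negative terms between centre and leaves remain.
    gain-star : ∀ k α (l : Fin n → ℚ) → 0ℚ ≤ α → (∀ v → 0ℚ ≤ l v) →
                (∀ u v → w u v * (l u * l v) ≡ 0ℚ) →
                Gain (λ v → δ k v * α + l v) (α * sum λ v → l v * (w k v + w v k))
    gain-star k α l 0≤α 0≤l independent = gain-± z z≤ -z≤ (≤-reflexive total)
      where
      z : Fin n → ℚ
      z v = δ k v * α - l v

      0≤δ : ∀ v → 0ℚ ≤ δ k v * α
      0≤δ v = 0≤𝟙 (k Fin.≟ v) ⊠ 0≤α

      z≤ : ∀ v → z v ≤ δ k v * α + l v
      z≤ v = ≤-cert (0≤l v ⊞ 0≤l v) (eq (δ k v * α) (l v))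
        where
        eq : ∀ a l → a + l ≡ a - l + (l + l)
        eq = solve-∀ ring

      -z≤ : ∀ v → - z v ≤ δ k v * α + l v
      -z≤ v = ≤-cert (0≤δ v ⊞ 0≤δ v) (eq (δ k v * α) (l v))
        where
        eq : ∀ a l → a + l ≡ - (a - l) + (a + a)
        eq = solve-∀ ring

      out inn q : Fin n → Fin n → ℚ
      out u v = δ k u * (α * (l v * w u v))
      inn u v = δ k v * (α * (l u * w u v))
      q u v = w u v * (z u * z v)

      sum-out : sum₂ out ≡ α * sum (λ v → l v * w k v)
      sum-out = trans (sum-cong-≗ λ u → sym (*-distribˡ-sum (δ k u) (λ v → α * (l v * w u v))))
        (trans (sum-δ k (λ u → sum λ v → α * (l v * w u v)))
          (sym (*-distribˡ-sum α (λ v → l v * w k v))))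

      sum-inn : sum₂ inn ≡ α * sum (λ u → l u * w u k)
      sum-inn = trans (sum-cong-≗ λ u → sum-δ k (λ v → α * (l u * w u v)))
        (sym (*-distribˡ-sum α (λ u → l u * w u k)))

      split : α * sum (λ v → l v * (w k v + w v k)) ≡ sum₂ out + sum₂ inn
      split = trans (cong (α *_) (trans (sum-cong-≗ λ v → *-distribˡ-+ (l v) (w k v) (w v k))
                                   (∑-distrib-+ (λ v → l v * w k v) (λ v → l v * w v k))))
        (trans (*-distribˡ-+ α _ _) (sym (cong₂ _+_ sum-out sum-inn)))

      pointwise : ∀ u v → out u v + inn u v + q u v ≡ 0ℚ
      pointwise u v = trans (eq (w u v) (δ k u) (δ k v) α (l u) (l v))
        (trans (cong₂ (λ x y → x * (α * α) + y) (loop≡0 k u v) (independent u v))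
          (trans (+-identityʳ (0ℚ * (α * α))) (*-zeroˡ (α * α))))
        where
        eq : ∀ w d e a x y →
             d * (a * (y * w)) + e * (a * (x * w)) + w * ((d * a - x) * (e * a - y))
             ≡ w * (d * e) * (a * a) + w * (x * y)
        eq = solve-∀ ring

      total : α * sum (λ v → l v * (w k v + w v k)) + Q z ≡ 0ℚ
      total = trans (cong (_+ Q z) (trans split (sym (sum₂-+ out inn))))
        (trans (sym (sum₂-+ (λ u v → out u v + inn u v) q)) (sum₂-zero pointwise))

    -- The star moves are made in turn, so radii add: a vertex is charged once as a centre and once
    -- for every star in which it is a leaf.
    gain-stars : ∀ (α : Fin n → ℚ) (l : Fin n → Fin n → ℚ) → (∀ k → 0ℚ ≤ α k) →
                 (∀ k v → 0ℚ ≤ l k v) → (∀ k u v → w u v * (l k u * l k v) ≡ 0ℚ) →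
                 Gain (λ v → α v + sum λ k → l k v)
                      (sum λ k → α k * sum λ v → l k v * (w k v + w v k))
    gain-stars α l 0≤α 0≤l independent = gain-mono radius ≤-refl
      (gain-sum λ k → gain-star k (α k) (l k) (0≤α k) (0≤l k) (independent k))
      where
      radius : ∀ v → sum (λ k → δ k v * α k + l k v) ≤ α v + sum λ k → l k v
      radius v = ≤-reflexive (trans (∑-distrib-+ (λ k → δ k v * α k) (λ k → l k v))
        (cong (_+ sum (λ k → l k v))
          (trans (sum-cong-≗ λ k → cong (_* α k) (δ-sym k v)) (sum-δ v α))))

  -- Counting vertices by rational sums

  ι : ℕ → ℚ
  ι zero    = 0ℚ
  ι (suc m) = 1ℚ + ι m

  0≤ι : ∀ m → 0ℚ ≤ ι m
  0≤ι zero    = ≤-refl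
  0≤ι (suc m) = 0≤1 ⊞ 0≤ι m

  ι-mono-≤ : ∀ {l m} → l ℕ.≤ m → ι l ≤ ι m
  ι-mono-≤ {m = m} ℕ.z≤n = 0≤ι m
  ι-mono-≤ (ℕ.s≤s l≤m) = +-monoʳ-≤ 1ℚ (ι-mono-≤ l≤m)

  ι-∣∣ : ∀ {n} (X : Subset n) → ι ∣ X ∣ ≡ sum (indicator X)
  ι-∣∣ Vec.[]            = refl
  ι-∣∣ (inside Vec.∷ X)  = cong (1ℚ +_) (ι-∣∣ X)
  ι-∣∣ (outside Vec.∷ X) = trans (ι-∣∣ X) (sym (+-identityˡ _))

  module _ {n : ℕ} {P : Fin n → Set} (P? : ∀ k → Dec (P k)) where

    subset : Subset n
    subset = tabulate λ k → does (P? k)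

    ∈-subset⁺ : ∀ {k} → P k → k Subset.∈ subset
    ∈-subset⁺ {k} Pk = lookup⇒[]= k subset
      (trans (lookup∘tabulate (λ k → does (P? k)) k) (dec-true (P? k) Pk))

    ∈-subset⁻ : ∀ {k} → k Subset.∈ subset → P k
    ∈-subset⁻ {k} k∈ with P? k | trans (sym (lookup∘tabulate (λ k → does (P? k)) k)) ([]=⇒lookup k∈)
    ... | yes Pk | _ = Pk
    ... | no _   | ()

    ι-∣subset∣ : ι ∣ subset ∣ ≡ sum λ k → 𝟙 (P? k)
    ι-∣subset∣ = trans (ι-∣∣ subset) (sum-cong-≗ λ k →
      cong (λ b → if b then 1ℚ else 0ℚ) (lookup∘tabulate (λ k → does (P? k)) k))

  𝟙-× : ∀ {a b} {A : Set a} {B : Set b} (A? : Dec A) (B? : Dec B) → 𝟙 (A? ×-dec B?) ≡ 𝟙 A? * 𝟙 B?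
  𝟙-× (yes _) B? = sym (*-identityˡ (𝟙 B?))
  𝟙-× (no _)  B? = sym (*-zeroˡ (𝟙 B?))

  -- A discrete intermediate value argument, searching downwards from `n`.
  crossing : ∀ {P : ℕ → Set} → (∀ m → Dec (P m)) → P 0 → ∀ {n} → ¬ P n → ∃[ m ] (P m × ¬ P (suc m))
  crossing P? P0 {zero}  ¬Pn = ⊥-elim (¬Pn P0)
  crossing P? P0 {suc n} ¬Pn with P? n
  ... | yes Pn = n , Pn , ¬Pn
  ... | no ¬Pn′ = crossing P? P0 ¬Pn′

  -- The arithmetic of the final contradiction

  ½x<x : ∀ {x} → 0ℚ < x → ½ * x < x
  ½x<x {x} 0<x = subst₂ _<_ (+-identityʳ (½ * x)) (eq x)
    (+-monoʳ-< (½ * x) (subst (_< ½ * x) (*-zeroʳ ½) (*-monoʳ-<-pos ½ 0<x)))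
    where
    eq : ∀ x → ½ * x + ½ * x ≡ x
    eq = solve-∀ ring

  -- Here `s` stands for the weight of the arcs shorter than `l`. At least half of the weight
  -- remains, so `Z` is at least `l W / 2`, while `W` is at most `32 σ l`.
  median-arithmetic : ∀ {W σ Z s l} → 0ℚ ≤ W → 0ℚ ≤ σ → 0ℚ ≤ l →
    s ≤ ½ * W → ½ * W ≤ l * (16ℚ * σ) → l * W ≤ Z + l * s → W * W ≤ 64ℚ * σ * Z
  median-arithmetic {W} {σ} {Z} {s} {l} 0≤W 0≤σ 0≤l s≤ ½W≤ lW≤ =
    ≤-cert (2* (0≤W ⊠ ≤⇒0≤ ½W≤) ⊞ 64* (0≤σ ⊠ (≤⇒0≤ lW≤ ⊞ 0≤l ⊠ ≤⇒0≤ s≤))) (eq W σ l Z s)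
    where
    2* : ∀ {x} → 0ℚ ≤ x → 0ℚ ≤ (1ℚ + 1ℚ) * x
    2* = nonNegative⁻¹ (1ℚ + 1ℚ) ⊠_
    64* : ∀ {x} → 0ℚ ≤ x → 0ℚ ≤ 64ℚ * x
    64* = nonNegative⁻¹ 64ℚ ⊠_

    eq : ∀ W σ l Z s → 64ℚ * σ * Z ≡ W * W +
         ((1ℚ + 1ℚ) * (W * (l * (16ℚ * σ) - ½ * W)) +
          64ℚ * (σ * (Z + l * s - l * W + l * (½ * W - s))))
    eq = solve-∀ ring

  0<* : ∀ {x y} → 0ℚ < x → 0ℚ < y → 0ℚ < x * y
  0<* {x} {y} 0<x 0<y = subst (_< x * y) (*-zeroˡ y) (*-monoˡ-<-pos y {{positive 0<y}} 0<x)

  divide : ∀ x {y} → 0ℚ < y → ∃[ q ] q * y ≡ x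
  divide x {y} 0<y = x * 1/ y , trans (*-assoc x (1/ y) y)
    (trans (cong (x *_) (*-inverseˡ y)) (*-identityʳ x))
    where instance
      y≢0 : NonZero y
      y≢0 = pos⇒nonZero y {{positive 0<y}}

  -- The choice ε = W / (12 τ²) nearly maximizes ε Z - τ ε² W when W² = 6 τ Z.
  tilt-arithmetic : ∀ {W τ Z} → 0ℚ < W → 0ℚ < τ → W * W ≤ 6ℚ * τ * Z → Z ≤ τ * W →
    (∀ ε → 0ℚ ≤ ε → ε ≤ ½ → ε * Z ≤ τ * (⅛ * τ + ε * ε * W)) →
    W * W * W ≤ 18ℚ * (τ * τ * τ * τ * τ)
  tilt-arithmetic {W} {τ} {Z} 0<W 0<τ W²≤6τZ Z≤τW tilt-Z =
    ≤-cert (2* (≤⇒0≤ halved)) (eq (W * W * W) τ)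
    where
    D : ℚ
    D = 12ℚ * (τ * τ)

    0<D : 0ℚ < D
    0<D = 0<* (positive⁻¹ 12ℚ) (0<* 0<τ 0<τ)

    ε : ℚ
    ε = proj₁ (divide W 0<D)

    εD≡W : ε * D ≡ W
    εD≡W = proj₂ (divide W 0<D)

    2* : ∀ {x} → 0ℚ ≤ x → 0ℚ ≤ (1ℚ + 1ℚ) * x
    2* = nonNegative⁻¹ (1ℚ + 1ℚ) ⊠_
    6τ* : ∀ {x} → 0ℚ ≤ x → 0ℚ ≤ 6ℚ * τ * x
    6τ* = nonNegative⁻¹ 6ℚ ⊠ <⇒≤ 0<τ ⊠_

    -- Since `W² ≤ 6 τ Z ≤ 6 τ² W`; this is what makes `ε` at most `½`.
    W≤½D : W ≤ ½ * D
    W≤½D = *-cancelʳ-≤ 0<W (≤-cert (≤⇒0≤ W²≤6τZ ⊞ 6τ* (≤⇒0≤ Z≤τW)) (eq₁ W τ Z))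
      where
      eq₁ : ∀ W τ Z → ½ * (12ℚ * (τ * τ)) * W ≡ W * W + (6ℚ * τ * Z - W * W + 6ℚ * τ * (τ * W - Z))
      eq₁ = solve-∀ ring

    0≤ε : 0ℚ ≤ ε
    0≤ε = *-cancelʳ-≤ 0<D (subst₂ _≤_ (sym (*-zeroˡ D)) (sym εD≡W) (<⇒≤ 0<W))

    ε≤½ : ε ≤ ½
    ε≤½ = *-cancelʳ-≤ 0<D (subst (_≤ ½ * D) (sym εD≡W) W≤½D)

    unscaled : ε * (W * W) ≤ ½ * D * (⅛ * τ + ε * ε * W)
    unscaled = ≤-cert (0≤ε ⊠ ≤⇒0≤ W²≤6τZ ⊞ 6τ* (≤⇒0≤ (tilt-Z ε 0≤ε ε≤½))) (eq₁ W τ Z ε)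
      where
      eq₁ : ∀ W τ Z ε → ½ * (12ℚ * (τ * τ)) * (⅛ * τ + ε * ε * W) ≡
            ε * (W * W) + (ε * (6ℚ * τ * Z - W * W) + 6ℚ * τ * (τ * (⅛ * τ + ε * ε * W) - ε * Z))
      eq₁ = solve-∀ ring

    -- Multiplying by `D * D` turns each `ε * D` into `W`. Once `D` is cancelled, half of `W³` moves
    -- to the left, and `12² / 8 = 18` is the final constant.
    scaled : W * W * W * D ≤ (½ * (⅛ * τ * (D * D)) + ½ * (W * W * W)) * D
    scaled = ≤-cert (≤⇒0≤ unscaled ⊠ (<⇒≤ 0<D ⊠ <⇒≤ 0<D)) (eq₁ τ {ε} (sym εD≡W))
      where
      eq₂ : ∀ τ ε D → (½ * (⅛ * τ * (D * D)) + ½ * (ε * D * (ε * D) * (ε * D))) * D ≡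
            ε * D * (ε * D) * (ε * D) * D +
            (½ * D * (⅛ * τ + ε * ε * (ε * D)) - ε * (ε * D * (ε * D))) * (D * D)
      eq₂ = solve-∀ ring
      eq₁ : ∀ τ {ε D W} → W ≡ ε * D → (½ * (⅛ * τ * (D * D)) + ½ * (W * W * W)) * D ≡
            W * W * W * D + (½ * D * (⅛ * τ + ε * ε * W) - ε * (W * W)) * (D * D)
      eq₁ τ {ε} {D} refl = eq₂ τ ε D

    halved : W * W * W ≤ ½ * (⅛ * τ * (D * D)) + ½ * (W * W * W)
    halved = *-cancelʳ-≤ 0<D scaled

    eq : ∀ w τ → 18ℚ * (τ * τ * τ * τ * τ) ≡ w +
         (1ℚ + 1ℚ) * (½ * (⅛ * τ * (12ℚ * (τ * τ) * (12ℚ * (τ * τ)))) + ½ * w - w)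
    eq = solve-∀ ring

  -- Rational weights, zero or at least one, directed along an order of the vertices

  module ArcWeights {n : ℕ} (w : Fin n → Fin n → ℚ) (key : Fin n → ℕ)
    (arc⊎0 : ∀ u v → (1ℚ ≤ w u v × key u ℕ.< key v) ⊎ w u v ≡ 0ℚ)
    where

    IsArc : Fin n → Fin n → Set
    IsArc u v = 1ℚ ≤ w u v × key u ℕ.< key v

    0≤w : ∀ u v → 0ℚ ≤ w u v
    0≤w u v with arc⊎0 u v
    ... | inj₁ (1≤w , _) = ≤-trans 0≤1 1≤w
    ... | inj₂ w≡0       = ≤-reflexive (sym w≡0)

    loopless : ∀ v → w v v ≡ 0ℚ
    loopless v with arc⊎0 v v
    ... | inj₁ (_ , v<v) = ⊥-elim (ℕ.<-irrefl refl v<v)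
    ... | inj₂ w≡0       = w≡0

  -- The contradictory assumption that no fractional cut exceeds W / 4 + σ

  module SmallCuts {n : ℕ} (w : Fin n → Fin n → ℚ) (key : Fin n → ℕ)
    (arc⊎0 : ∀ u v → (1ℚ ≤ w u v × key u ℕ.< key v) ⊎ w u v ≡ 0ℚ)
    (σ : ℚ) (small : ∀ p → (∀ v → IsProbability (p v)) → Cut.E w p < ¼ * Cut.W w + σ)
    (key-injective : ∀ {u v} → key u ≡ key v → u ≡ v)
    where
    open Cut w
    open ArcWeights w key arc⊎0

    E-½ : E (λ _ → ½) ≡ ¼ * W
    E-½ = trans (sum₂-cong λ u v → *-comm (w u v) (½ * (1ℚ - ½))) (sym (*-distribˡ-sum₂ ¼ w))

    -- The move starts at the constant `½`, where `E` is a quarter of `W`. A radius of at most `½`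
    -- keeps the result in the unit cube, so `small` applies to it.
    gain<σ : ∀ {r γ} → (∀ v → r v ≤ ½) → Gain r γ → γ < σ
    gain<σ {r} {γ} r≤½ gain with p , p≤ , ≤p , up ← gain (λ _ → ½) =
      +-cancelˡ-< (¼ * W) (≤-<-trans (subst (λ e → e + γ ≤ E p) E-½ up)
        (small p λ v →
            ≤-cert (≤⇒0≤ (≤p v) ⊞ ≤⇒0≤ (r≤½ v)) (eq (p v) (r v))
          , ≤-trans (p≤ v) (+-monoʳ-≤ ½ (r≤½ v))))
      where
      eq : ∀ p r → p ≡ 0ℚ + (p + r - ½ + (½ - r))
      eq = solve-∀ ring

    0<σ : 0ℚ < σ
    0<σ = gain<σ (λ _ → 0≤½) gain-0

  -- A maximal matching

    -- A star with centre `u` and the single leaf `v`, both with coefficient `½`, gains a quarter of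
    -- the weight between them.
    gain-arc : ∀ u v → 1ℚ ≤ w u v → Gain (λ x → δ u x * ½ + δ v x * ½) ¼
    gain-arc u v 1≤w = gain-mono (λ _ → ≤-refl) ¼≤
      (gain-star w loopless u ½ (λ x → δ v x * ½) 0≤½ (λ x → 0≤𝟙 (v Fin.≟ x) ⊠ 0≤½)
        λ x y → trans (eq (w x y) (δ v x) (δ v y))
          (trans (cong (_* ¼) (loop≡0 w loopless v x y)) (*-zeroˡ ¼)))
      where
      eq : ∀ w d e → w * (d * ½ * (e * ½)) ≡ w * (d * e) * ¼
      eq = solve-∀ ring
      eq′ : ∀ a b → ½ * (½ * (a + b)) ≡ ¼ + ¼ * (a - 1ℚ + b)
      eq′ = solve-∀ ring

      ¼≤ : ¼ ≤ ½ * sum (λ x → δ v x * ½ * (w u x + w x u))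
      ¼≤ = ≤-cert (0≤¼ ⊠ (≤⇒0≤ 1≤w ⊞ 0≤w v u))
        (trans (cong (½ *_) (trans (sum-cong-≗ λ x → *-assoc (δ v x) ½ (w u x + w x u))
                               (sum-δ v λ x → ½ * (w u x + w x u))))
          (eq′ (w u v) (w v u)))

    -- r is half the indicator function of the set of matched vertices.
    record Matching (arcs : List (Fin n × Fin n)) : Set where
      field
        r       : Fin n → ℚ
        γ       : ℚ
        gain    : Gain r γ
        halves  : ∀ v → r v ≡ 0ℚ ⊎ r v ≡ ½
        size    : sum r ≤ γ * 4ℚ
        maximal : ∀ {u v} → (u , v) ∈ arcs → 1ℚ ≤ w u v → r u ≡ ½ ⊎ r v ≡ ½

    -- An arc is added exactly when both of its ends are still unmatched; otherwise a matched end
    -- witnesses maximality, and it stays matched later.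
    greedy : ∀ arcs → Matching arcs
    greedy [] = record
      { r = λ _ → 0ℚ ; γ = 0ℚ ; gain = gain-0 ; halves = λ _ → inj₁ refl
      ; size = ≤-reflexive (sum-zero {n} λ _ → refl) ; maximal = λ () }
    greedy ((a , b) ∷ arcs) with greedy arcs
    ... | M with arc⊎0 a b | Matching.halves M a | Matching.halves M b
    ... | inj₂ w≡0 | _ | _ = record
      { Matching M ; maximal = λ
        { (here refl) 1≤w → ⊥-elim (1≤⇒≢0 1≤w w≡0)
        ; (there uv)  1≤w → Matching.maximal M uv 1≤w } }
    ... | inj₁ _ | inj₂ ra≡½ | _ = record
      { Matching M ; maximal = λ
        { (here refl) 1≤w → inj₁ ra≡½
        ; (there uv)  1≤w → Matching.maximal M uv 1≤w } }
    ... | inj₁ _ | inj₁ _ | inj₂ rb≡½ = record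
      { Matching M ; maximal = λ
        { (here refl) 1≤w → inj₂ rb≡½
        ; (there uv)  1≤w → Matching.maximal M uv 1≤w } }
    ... | inj₁ (1≤w , a<b) | inj₁ ra≡0 | inj₁ rb≡0 = record
      { r = r′ ; γ = γ + ¼ ; gain = gain-+ gain (gain-arc a b 1≤w)
      ; halves = halves′ ; size = size′
      ; maximal = λ
        { (here refl) _  → inj₁ ra′
        ; (there uv) 1≤w → [ inj₁ ∘ keep _ , inj₂ ∘ keep _ ]′ (maximal uv 1≤w) } }
      where
      open Matching M

      r′ : Fin n → ℚ
      r′ x = r x + (δ a x * ½ + δ b x * ½)

      halves′ : ∀ x → r′ x ≡ 0ℚ ⊎ r′ x ≡ ½
      halves′ x with a Fin.≟ x | b Fin.≟ x
      ... | yes refl | yes refl = ⊥-elim (ℕ.<-irrefl refl a<b)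
      ... | yes refl | no _     = inj₂ (cong (_+ ½) ra≡0)
      ... | no _     | yes refl = inj₂ (cong (_+ ½) rb≡0)
      ... | no _     | no _     rewrite +-identityʳ (r x) = halves x

      keep : ∀ x → r x ≡ ½ → r′ x ≡ ½
      keep x rx≡½ with a Fin.≟ x | b Fin.≟ x
      ... | yes refl | _        = case trans (sym ra≡0) rx≡½ of λ ()
      ... | no _     | yes refl = case trans (sym rb≡0) rx≡½ of λ ()
      ... | no _     | no _     = trans (+-identityʳ (r x)) rx≡½

      ra′ : r′ a ≡ ½
      ra′ with a Fin.≟ a | b Fin.≟ a
      ... | no a≢a | _        = ⊥-elim (a≢a refl)
      ... | yes _  | yes refl = ⊥-elim (ℕ.<-irrefl refl a<b)
      ... | yes _  | no _     = cong (_+ ½) ra≡0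

      eq : ∀ γ s → (γ + ¼) * 4ℚ ≡ s + (½ + ½) + (γ * 4ℚ - s)
      eq = solve-∀ ring

      -- The new arc adds `½` twice to the sum of `r`, and `¼` to `γ`.
      size′ : sum r′ ≤ (γ + ¼) * 4ℚ
      size′ = subst (_≤ (γ + ¼) * 4ℚ)
        (sym (trans (∑-distrib-+ r (λ x → δ a x * ½ + δ b x * ½)) (cong (sum r +_)
          (trans (∑-distrib-+ (λ x → δ a x * ½) (λ x → δ b x * ½))
            (cong₂ _+_ (sum-δ a λ _ → ½) (sum-δ b λ _ → ½))))))
        (≤-cert (≤⇒0≤ size) (eq γ (sum r)))

    matching : Matching (cartesianProduct (allFin n) (allFin n))
    matching = greedy (cartesianProduct (allFin n) (allFin n))

    open Matching matching using () renaming (r to matched)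

    covered : ∀ u v → 1ℚ ≤ w u v → matched u ≡ ½ ⊎ matched v ≡ ½
    covered u v = Matching.maximal matching (∈-cartesianProduct⁺ (∈-allFin u) (∈-allFin v))

    -- Weights are zero or at least one, so this says that some arc joins `k` and `v` in one
    -- direction or the other.
    Adjacent : Fin n → Fin n → Set
    Adjacent k v = 1ℚ ≤ w k v + w v k

    Active : Fin n → Set
    Active v = ∃[ k ] Adjacent k v

    active? : ∀ v → Dec (Active v)
    active? v = Fin.any? λ k → 1ℚ ≤? w k v + w v k

    neighbour-matched : ∀ {k v} → Adjacent k v → matched v ≡ 0ℚ → matched k ≡ ½
    neighbour-matched {k} {v} adj mv≡0 with arc⊎0 k v | arc⊎0 v k
    ... | inj₁ (1≤w , _) | _ with covered k v 1≤w
    ...   | inj₁ mk≡½ = mk≡½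
    ...   | inj₂ mv≡½ = case trans (sym mv≡0) mv≡½ of λ ()
    neighbour-matched {k} {v} adj mv≡0 | inj₂ _ | inj₁ (1≤w , _) with covered v k 1≤w
    ...   | inj₁ mv≡½ = case trans (sym mv≡0) mv≡½ of λ ()
    ...   | inj₂ mk≡½ = mk≡½
    neighbour-matched adj mv≡0 | inj₂ w≡0 | inj₂ w′≡0 =
      ⊥-elim (1≤⇒≢0 adj (cong₂ _+_ w≡0 w′≡0))

    -- Stars from matched to unmatched vertices, and the count of non-isolated vertices

    data Role (v : Fin n) : Set where
      centre : matched v ≡ ½ → Role v
      leaf   : ∀ k → Adjacent k v → matched v ≡ 0ℚ → Role v
      idle   : matched v ≡ 0ℚ → ¬ Active v → Role v

    role : ∀ v → Role v
    role v with Matching.halves matching v | active? v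
    ... | inj₂ mv≡½ | _              = centre mv≡½
    ... | inj₁ mv≡0 | yes (k , adj)  = leaf k adj mv≡0
    ... | inj₁ mv≡0 | no ¬active     = idle mv≡0 ¬active

    -- A leaf gives its whole coefficient `½` to the one neighbour chosen by its role, so it belongs
    -- to a single star even if it has several matched neighbours.
    attach : ∀ {v} → Role v → Fin n → ℚ
    attach (centre _)   _  = 0ℚ
    attach (leaf k _ _) k′ = δ k k′ * ½
    attach (idle _ _)   _  = 0ℚ

    leaf# : ∀ {v} → Role v → ℚ
    leaf# (centre _)   = 0ℚ
    leaf# (leaf _ _ _) = 1ℚ
    leaf# (idle _ _)   = 0ℚ

    0≤attach : ∀ {v} (ρ : Role v) k → 0ℚ ≤ attach ρ k
    0≤attach (centre _)   k  = ≤-refl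
    0≤attach (leaf k _ _) k′ = 0≤𝟙 (k Fin.≟ k′) ⊠ 0≤½
    0≤attach (idle _ _)   k  = ≤-refl

    0≤matched : ∀ v → 0ℚ ≤ matched v
    0≤matched v with Matching.halves matching v
    ... | inj₁ mv≡0 = ≤-reflexive (sym mv≡0)
    ... | inj₂ mv≡½ = subst (0ℚ ≤_) (sym mv≡½) 0≤½

    matched-unattached : ∀ {v} (ρ : Role v) k → matched v ≡ ½ → attach ρ k ≡ 0ℚ
    matched-unattached (centre _)      _ _    = refl
    matched-unattached (leaf _ _ mv≡0) _ mv≡½ = case trans (sym mv≡0) mv≡½ of λ ()
    matched-unattached (idle _ _)      _ _    = refl

    -- An arc has a matched end by maximality, and matched vertices are never leaves.
    attach-independent : ∀ k u v → w u v * (attach (role u) k * attach (role v) k) ≡ 0ℚ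
    attach-independent k u v with arc⊎0 u v
    ... | inj₂ w≡0 = p≡0⇒p*q≡0 (attach (role u) k * attach (role v) k) w≡0
    ... | inj₁ (1≤w , _) = q≡0⇒p*q≡0 (w u v) ([ u-matched , v-matched ]′ (covered u v 1≤w))
      where
      u-matched : matched u ≡ ½ → attach (role u) k * attach (role v) k ≡ 0ℚ
      u-matched mu≡½ = p≡0⇒p*q≡0 (attach (role v) k) (matched-unattached (role u) k mu≡½)
      v-matched : matched v ≡ ½ → attach (role u) k * attach (role v) k ≡ 0ℚ
      v-matched mv≡½ = q≡0⇒p*q≡0 (attach (role u) k) (matched-unattached (role v) k mv≡½)

    star-radius : ∀ {v} (ρ : Role v) → matched v + sum (attach ρ) ≤ ½
    star-radius (centre mv≡½)   = ≤-reflexive (cong₂ _+_ mv≡½ (sum-zero {n} λ _ → refl))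
    star-radius (leaf k _ mv≡0) = ≤-reflexive (cong₂ _+_ mv≡0 (sum-δ k λ _ → ½))
    star-radius (idle mv≡0 _)   = ≤-trans (≤-reflexive (cong₂ _+_ mv≡0 (sum-zero {n} λ _ → refl))) 0≤½

    -- The centre of a leaf is matched; two coefficients `½` against a joining weight of at least
    -- one give `¼`.
    leaf-gain : ∀ {v} (ρ : Role v) →
                ¼ * leaf# ρ ≤ sum λ k → matched k * (attach ρ k * (w k v + w v k))
    leaf-gain {v} (leaf k adj mv≡0) = ≤-cert (0≤¼ ⊠ ≤⇒0≤ adj)
      (trans (sum-cong-≗ λ k′ → eq₁ (matched k′) (δ k k′) (w k′ v + w v k′))
        (trans (sum-δ k λ k′ → matched k′ * (½ * (w k′ v + w v k′)))
          (trans (cong (_* _) (neighbour-matched adj mv≡0)) (eq₂ (w k v + w v k)))))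
      where
      eq₁ : ∀ m d x → m * (d * ½ * x) ≡ d * (m * (½ * x))
      eq₁ = solve-∀ ring
      eq₂ : ∀ x → ½ * (½ * x) ≡ ¼ * 1ℚ + ¼ * (x - 1ℚ)
      eq₂ = solve-∀ ring
    leaf-gain {v} ρ@(centre _) = 0≤sum λ k → 0≤matched k ⊠ (0≤attach ρ k ⊠ (0≤w k v ⊞ 0≤w v k))
    leaf-gain {v} ρ@(idle _ _) = 0≤sum λ k → 0≤matched k ⊠ (0≤attach ρ k ⊠ (0≤w k v ⊞ 0≤w v k))

    leaves : ℚ
    leaves = sum λ v → leaf# (role v)

    -- All stars are used together, and exchanging the sums counts their gain leaf by leaf.
    leaves-gain : ¼ * leaves < σ
    leaves-gain = ≤-<-trans
      (≤-trans (≤-trans (≤-reflexive (*-distribˡ-sum ¼ λ v → leaf# (role v)))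
                  (sum-mono-≤ λ v → leaf-gain (role v)))
        (≤-reflexive (trans (∑-comm λ v k → matched k * (attach (role v) k * (w k v + w v k)))
          (sum-cong-≗ λ k → sym (*-distribˡ-sum (matched k) λ v → attach (role v) k * (w k v + w v k))))))
      (gain<σ (λ v → star-radius (role v))
        (gain-stars w loopless matched (λ k v → attach (role v) k) 0≤matched
          (λ k v → 0≤attach (role v) k) attach-independent))

    actives : ℚ
    actives = sum λ v → 𝟙 (active? v)

    active≤ : ∀ {v} (ρ : Role v) → 𝟙 (active? v) ≤ matched v + matched v + leaf# ρ
    active≤ {v} (centre mv≡½) = subst (λ m → 𝟙 (active? v) ≤ m + m + 0ℚ) (sym mv≡½) (𝟙≤1 (active? v))
    active≤ {v} (leaf _ _ mv≡0) = subst (λ m → 𝟙 (active? v) ≤ m + m + 1ℚ) (sym mv≡0) (𝟙≤1 (active? v))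
    active≤ {v} (idle mv≡0 ¬active) = subst (λ m → 𝟙 (active? v) ≤ m + m + 0ℚ) (sym mv≡0)
      (≤-reflexive (𝟙-no (active? v) ¬active))

    -- The matched vertices number twice the sum of `matched`, hence at most `8 γ ≤ 8 σ`; the leaves
    -- number at most `4 σ`.
    actives≤12σ : actives ≤ 12ℚ * σ
    actives≤12σ = ≤-trans (sum-mono-≤ λ v → active≤ (role v))
      (subst (_≤ 12ℚ * σ)
        (sym (trans (∑-distrib-+ (λ v → matched v + matched v) (λ v → leaf# (role v)))
          (cong (_+ leaves) (∑-distrib-+ matched matched))))
        (≤-cert (≤⇒0≤ size ⊞ ≤⇒0≤ size ⊞ 8* (≤⇒0≤ (<⇒≤ (gain<σ half gain))) ⊞ 4* (≤⇒0≤ (<⇒≤ leaves-gain)))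
          (eq σ γ (sum matched) leaves)))
      where
      open Matching matching using (γ; gain; size; halves)

      8* : ∀ {x} → 0ℚ ≤ x → 0ℚ ≤ (4ℚ + 4ℚ) * x
      8* = nonNegative⁻¹ (4ℚ + 4ℚ) ⊠_
      4* : ∀ {x} → 0ℚ ≤ x → 0ℚ ≤ 4ℚ * x
      4* = nonNegative⁻¹ 4ℚ ⊠_

      half : ∀ v → matched v ≤ ½
      half v with halves v
      ... | inj₁ mv≡0 = subst (_≤ ½) (sym mv≡0) 0≤½
      ... | inj₂ mv≡½ = ≤-reflexive mv≡½

      eq : ∀ σ γ m l → 12ℚ * σ ≡ m + m + l +
           (γ * 4ℚ - m + (γ * 4ℚ - m) + (4ℚ + 4ℚ) * (σ - γ) + 4ℚ * (σ - ¼ * l))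
      eq = solve-∀ ring

  -- Arc lengths

    arc? : ∀ u v → Dec (IsArc u v)
    arc? u v = (1ℚ ≤? w u v) ×-dec (key u ℕ.<? key v)

    tail-active : ∀ {u v} → IsArc u v → Active u
    tail-active {u} {v} (1≤w , _) = v , ≤-trans 1≤w
      (subst (_≤ w v u + w u v) (+-identityˡ (w u v)) (+-monoˡ-≤ (w u v) (0≤w v u)))

    head-active : ∀ {u v} → IsArc u v → Active v
    head-active {u} {v} (1≤w , _) = u , ≤-trans 1≤w
      (subst (_≤ w u v + w v u) (+-identityʳ (w u v)) (+-monoʳ-≤ (w u v) (0≤w v u)))

    -- Equivalently, an arc from `u` to `v` crosses the cut directly after `k` in key order.
    Side : Fin n → Fin n → Fin n → Set
    Side u v k = key u ℕ.≤ key k × key k ℕ.< key v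

    side? : ∀ u v k → Dec (Side u v k)
    side? u v k = (key u ℕ.≤? key k) ×-dec (key k ℕ.<? key v)

    between? : ∀ u v k → Dec (Active k × Side u v k)
    between? u v k = active? k ×-dec side? u v k

    between : Fin n → Fin n → Subset n
    between u v = subset (between? u v)

    -- The tail of an arc is counted and its head is not, so arcs have positive length, and the
    -- length is the number of cuts after active vertices that the arc crosses.
    len : Fin n → Fin n → ℕ
    len u v = ∣ between u v ∣

    len>0 : ∀ {u v} → IsArc u v → 0 ℕ.< len u v
    len>0 {u} {v} uv@(_ , u<v) = ℕ.<-≤-trans (ℕ.s≤s ℕ.z≤n) (Subset.x∈p⇒∣p-x∣<∣p∣
      (∈-subset⁺ (between? u v) (tail-active uv , ℕ.≤-refl , u<v)))

    -- Strictness is witnessed by `u`, which is active as the head of an arc and lies before `v` but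
    -- not before itself.
    len-monoʳ-< : ∀ {a u v} → IsArc a u → key u ℕ.< key v → len a u ℕ.< len a v
    len-monoʳ-< {a} {u} {v} au@(_ , a<u) u<v = Subset.p⊂q⇒∣p∣<∣q∣
      ( (λ k∈ → let (act , a≤k , k<u) = ∈-subset⁻ (between? a u) k∈ in
                ∈-subset⁺ (between? a v) (act , a≤k , ℕ.<-trans k<u u<v))
      , u , ∈-subset⁺ (between? a v) (head-active au , ℕ.<⇒≤ a<u , u<v)
      , λ u∈ → ℕ.<-irrefl refl (proj₂ (proj₂ (∈-subset⁻ (between? a u) u∈))))

    len-monoˡ-< : ∀ {u v b} → IsArc u b → key u ℕ.< key v → len v b ℕ.< len u b
    len-monoˡ-< {u} {v} {b} ub@(_ , u<b) u<v = Subset.p⊂q⇒∣p∣<∣q∣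
      ( (λ k∈ → let (act , v≤k , k<b) = ∈-subset⁻ (between? v b) k∈ in
                ∈-subset⁺ (between? u b) (act , ℕ.≤-trans (ℕ.<⇒≤ u<v) v≤k , k<b))
      , u , ∈-subset⁺ (between? u b) (tail-active ub , ℕ.≤-refl , u<b)
      , λ u∈ → ℕ.<⇒≱ u<v (proj₁ (proj₂ (∈-subset⁻ (between? v b) u∈))))

    LenArc : ℕ → Fin n → Fin n → Set
    LenArc ℓ u v = IsArc u v × len u v ≡ ℓ

    lenArc? : ∀ ℓ u v → Dec (LenArc ℓ u v)
    lenArc? ℓ u v = arc? u v ×-dec (len u v ℕ.≟ ℓ)

    -- Length grows strictly with the head while the tail is fixed. Together with `tail-unique` this
    -- makes the paths formed by arcs of length `ℓ` disjoint.
    head-unique : ∀ {ℓ a u v} → LenArc ℓ a u → LenArc ℓ a v → u ≡ v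
    head-unique {u = u} {v} (au , refl) (av , eq) with ℕ.<-cmp (key u) (key v)
    ... | tri< u<v _ _ = ⊥-elim (ℕ.<-irrefl (sym eq) (len-monoʳ-< au u<v))
    ... | tri≈ _ u≡v _ = key-injective u≡v
    ... | tri> _ _ v<u = ⊥-elim (ℕ.<-irrefl eq (len-monoʳ-< av v<u))

    tail-unique : ∀ {ℓ b u v} → LenArc ℓ u b → LenArc ℓ v b → u ≡ v
    tail-unique {u = u} {v} (ub , refl) (vb , eq) with ℕ.<-cmp (key u) (key v)
    ... | tri< u<v _ _ = ⊥-elim (ℕ.<-irrefl eq (len-monoˡ-< ub u<v))
    ... | tri≈ _ u≡v _ = key-injective u≡v
    ... | tri> _ _ v<u = ⊥-elim (ℕ.<-irrefl (sym eq) (len-monoˡ-< vb v<u))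

    -- The weight of the arcs of a given length

    weight-of-len : ℕ → ℚ
    weight-of-len ℓ = sum₂ λ u v → w u v * 𝟙 (len u v ℕ.≟ ℓ)

    -- The arcs of length ℓ form disjoint paths, so the stars from the tails may
    -- all be used at once with coefficient ¼.
    weight-of-len≤ : ∀ ℓ → weight-of-len ℓ ≤ 16ℚ * σ
    weight-of-len≤ ℓ = ≤-cert (16* (≤⇒0≤ (≤-trans gain≥ (<⇒≤ (gain<σ radius gain))))) (eq σ (weight-of-len ℓ))
      where
      l : Fin n → Fin n → ℚ
      l k v = ¼ * 𝟙 (lenArc? ℓ k v)

      0≤l : ∀ k v → 0ℚ ≤ l k v
      0≤l k v = 0≤¼ ⊠ 0≤𝟙 (lenArc? ℓ k v)

      -- The star at `k` has at most one leaf, so only a loop could violate independence.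
      independent : ∀ k u v → w u v * (l k u * l k v) ≡ 0ℚ
      independent k u v = disjoint (lenArc? ℓ k u) (lenArc? ℓ k v)
        where
        disjoint : (d : Dec (LenArc ℓ k u)) (e : Dec (LenArc ℓ k v)) →
                   w u v * (¼ * 𝟙 d * (¼ * 𝟙 e)) ≡ 0ℚ
        disjoint (no _)   e        = q≡0⇒p*q≡0 (w u v) (*-zeroˡ (¼ * 𝟙 e))
        disjoint (yes _)  (no _)   = *-zeroʳ (w u v)
        disjoint (yes ku) (yes kv) = p≡0⇒p*q≡0 (¼ * 1ℚ * (¼ * 1ℚ))
          (trans (cong (w u) (sym (head-unique ku kv))) (loopless u))

      γ : ℚ
      γ = sum λ k → ¼ * sum λ v → l k v * (w k v + w v k)

      gain : Gain (λ v → ¼ + sum λ k → l k v) γ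
      gain = gain-stars w loopless (λ _ → ¼) l (λ _ → 0≤¼) 0≤l independent

      -- By `tail-unique`, `v` is a leaf of at most one star: `¼` as a centre and at most `¼` as a
      -- leaf.
      radius : ∀ v → ¼ + sum (λ k → l k v) ≤ ½
      radius v = +-monoʳ-≤ ¼ (subst (_≤ ¼) (*-distribˡ-sum ¼ λ k → 𝟙 (lenArc? ℓ k v))
        (≤-cert (0≤¼ ⊠ ≤⇒0≤ (sum-𝟙≤1 (λ k → lenArc? ℓ k v) tail-unique))
          (eq₁ (sum λ k → 𝟙 (lenArc? ℓ k v)))))
        where
        eq₁ : ∀ x → ¼ ≡ ¼ * x + ¼ * (1ℚ - x)
        eq₁ = solve-∀ ring

      pointwise : ∀ k v → ¼ * ¼ * (w k v * 𝟙 (len k v ℕ.≟ ℓ)) ≤ ¼ * (l k v * (w k v + w v k))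
      pointwise k v with arc⊎0 k v
      ... | inj₂ w≡0 = subst (_≤ ¼ * (l k v * (w k v + w v k)))
        (sym (q≡0⇒p*q≡0 (¼ * ¼) (p≡0⇒p*q≡0 (𝟙 (len k v ℕ.≟ ℓ)) w≡0)))
        (0≤¼ ⊠ (0≤l k v ⊠ (0≤w k v ⊞ 0≤w v k)))
      ... | inj₁ kv =
        ≤-cert (0≤¼ ⊠ 0≤¼ ⊠ (0≤𝟙 (len k v ℕ.≟ ℓ) ⊠ 0≤w v k))
          (trans (cong (λ d → ¼ * (¼ * d * (w k v + w v k)))
                   (trans (𝟙-× (arc? k v) (len k v ℕ.≟ ℓ)) (cong (_* 𝟙 (len k v ℕ.≟ ℓ)) (𝟙-yes (arc? k v) kv))))
            (eq₂ (𝟙 (len k v ℕ.≟ ℓ)) (w k v) (w v k)))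
        where
        eq₂ : ∀ d x y → ¼ * (¼ * (1ℚ * d) * (x + y)) ≡ ¼ * ¼ * (x * d) + ¼ * ¼ * (d * y)
        eq₂ = solve-∀ ring

      gain≥ : ¼ * ¼ * weight-of-len ℓ ≤ γ
      gain≥ = subst₂ _≤_ (sym (*-distribˡ-sum₂ (¼ * ¼) λ u v → w u v * 𝟙 (len u v ℕ.≟ ℓ)))
        (sum-cong-≗ λ k → sym (*-distribˡ-sum ¼ λ v → l k v * (w k v + w v k)))
        (sum₂-mono-≤ pointwise)

      16* : ∀ {x} → 0ℚ ≤ x → 0ℚ ≤ 16ℚ * x
      16* = nonNegative⁻¹ 16ℚ ⊠_

      eq : ∀ σ x → 16ℚ * σ ≡ x + 16ℚ * (σ - ¼ * ¼ * x)
      eq = solve-∀ ring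

    -- The median length and the weighted sum of lengths

    short : ℕ → ℚ
    short L = sum₂ λ u v → w u v * 𝟙 (len u v ℕ.≤? L)

    short-zero : short 0 ≤ 0ℚ
    short-zero = ≤-reflexive (sum₂-zero pointwise)
      where
      pointwise : ∀ u v → w u v * 𝟙 (len u v ℕ.≤? 0) ≡ 0ℚ
      pointwise u v with arc⊎0 u v
      ... | inj₁ uv  = q≡0⇒p*q≡0 (w u v) (𝟙-no (len u v ℕ.≤? 0) (ℕ.<⇒≱ (len>0 uv)))
      ... | inj₂ w≡0 = p≡0⇒p*q≡0 (𝟙 (len u v ℕ.≤? 0)) w≡0

    short-suc : ∀ L → short (suc L) ≤ short L + weight-of-len (suc L)
    short-suc L = subst (short (suc L) ≤_)
      (sum₂-+ (λ u v → w u v * 𝟙 (len u v ℕ.≤? L)) (λ u v → w u v * 𝟙 (len u v ℕ.≟ suc L)))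
      (sum₂-mono-≤ λ u v → subst (w u v * 𝟙 (len u v ℕ.≤? suc L) ≤_)
        (*-distribˡ-+ (w u v) (𝟙 (len u v ℕ.≤? L)) (𝟙 (len u v ℕ.≟ suc L)))
        (*-monoˡ-≤-nonNeg (w u v) {{nonNegative (0≤w u v)}} (split (len u v))))
      where
      split′ : ∀ m (d : Dec (m ℕ.≤ suc L)) → 𝟙 d ≤ 𝟙 (m ℕ.≤? L) + 𝟙 (m ℕ.≟ suc L)
      split′ m (no _) = 0≤𝟙 (m ℕ.≤? L) ⊞ 0≤𝟙 (m ℕ.≟ suc L)
      split′ m (yes m≤1+L) with ℕ.m≤n⇒m<n∨m≡n m≤1+L
      ... | inj₁ m<1+L = subst (λ x → 1ℚ ≤ x + 𝟙 (m ℕ.≟ suc L))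
        (sym (𝟙-yes (m ℕ.≤? L) (ℕ.s≤s⁻¹ m<1+L))) (+-monoʳ-≤ 1ℚ (0≤𝟙 (m ℕ.≟ suc L)))
      ... | inj₂ m≡1+L = subst (λ x → 1ℚ ≤ 𝟙 (m ℕ.≤? L) + x)
        (sym (𝟙-yes (m ℕ.≟ suc L) m≡1+L)) (+-monoˡ-≤ 1ℚ (0≤𝟙 (m ℕ.≤? L)))

      split : ∀ m → 𝟙 (m ℕ.≤? suc L) ≤ 𝟙 (m ℕ.≤? L) + 𝟙 (m ℕ.≟ suc L)
      split m = split′ m (m ℕ.≤? suc L)

    short≤ : ∀ L → short L ≤ ι L * (16ℚ * σ)
    short≤ zero    = ≤-trans short-zero (≤-reflexive (sym (*-zeroˡ (16ℚ * σ))))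
    short≤ (suc L) = ≤-trans (short-suc L)
      (≤-trans (+-mono-≤ (short≤ L) (weight-of-len≤ (suc L))) (≤-reflexive (eq (ι L) (16ℚ * σ))))
      where
      eq : ∀ l x → l * x + x ≡ (1ℚ + l) * x
      eq = solve-∀ ring

    short-all : short n ≡ W
    short-all = sum₂-cong λ u v → trans
      (cong (w u v *_) (𝟙-yes (len u v ℕ.≤? n) (Subset.∣p∣≤n (between u v))))
      (*-identityʳ (w u v))

    Z : ℚ
    Z = sum₂ λ u v → w u v * ι (len u v)

    -- Markov's inequality: an arc longer than `L` contributes at least `ι (suc L)` times its weight
    -- to `Z`, and the term with `short L` pays for the others.
    long≤Z : ∀ L → ι (suc L) * W ≤ Z + ι (suc L) * short L
    long≤Z L = subst₂ _≤_ (sym (*-distribˡ-sum₂ (ι (suc L)) w))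
      (trans (sum₂-+ (λ u v → w u v * ι (len u v)) (λ u v → ι (suc L) * (w u v * 𝟙 (len u v ℕ.≤? L))))
        (cong (Z +_) (sym (*-distribˡ-sum₂ (ι (suc L)) (λ u v → w u v * 𝟙 (len u v ℕ.≤? L))))))
      (sum₂-mono-≤ pointwise)
      where
      eq₁ : ∀ w l m → w * m + l * (w * 1ℚ) ≡ l * w + w * m
      eq₁ = solve-∀ ring
      eq₂ : ∀ w l m → w * m + l * (w * 0ℚ) ≡ l * w + w * (m - l)
      eq₂ = solve-∀ ring

      pointwise′ : ∀ u v (d : Dec (len u v ℕ.≤ L)) →
                   ι (suc L) * w u v ≤ w u v * ι (len u v) + ι (suc L) * (w u v * 𝟙 d)
      pointwise′ u v (yes _)  = ≤-cert (0≤w u v ⊠ 0≤ι (len u v))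
        (eq₁ (w u v) (ι (suc L)) (ι (len u v)))
      pointwise′ u v (no l≰L) = ≤-cert (0≤w u v ⊠ ≤⇒0≤ (ι-mono-≤ (ℕ.≰⇒> l≰L)))
        (eq₂ (w u v) (ι (suc L)) (ι (len u v)))

      pointwise : ∀ u v → ι (suc L) * w u v ≤ w u v * ι (len u v) + ι (suc L) * (w u v * 𝟙 (len u v ℕ.≤? L))
      pointwise u v = pointwise′ u v (len u v ℕ.≤? L)

    -- Cuts between initial and final segments of the order

    crossing-weight : Fin n → ℚ
    crossing-weight k = sum₂ λ u v → w u v * 𝟙 (side? u v k)

    crossing-weight≤W : ∀ k → crossing-weight k ≤ W
    crossing-weight≤W k = sum₂-mono-≤ λ u v → subst (w u v * 𝟙 (side? u v k) ≤_) (*-identityʳ (w u v))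
      (*-monoˡ-≤-nonNeg (w u v) {{nonNegative (0≤w u v)}} (𝟙≤1 (side? u v k)))

    -- Double counting: the length of an arc is the number of active `k` such that the arc crosses
    -- the cut after `k`.
    Z≡ : Z ≡ sum λ k → 𝟙 (active? k) * crossing-weight k
    Z≡ = sym (trans (sum-cong-≗ λ k → *-distribˡ-sum₂ (𝟙 (active? k)) (λ u v → w u v * 𝟙 (side? u v k)))
      (trans (sum-sum₂ (λ k u v → 𝟙 (active? k) * (w u v * 𝟙 (side? u v k)))) (sum₂-cong pointwise)))
      where
      eq : ∀ a w s → a * (w * s) ≡ w * (a * s)
      eq = solve-∀ ring

      pointwise : ∀ u v → sum (λ k → 𝟙 (active? k) * (w u v * 𝟙 (side? u v k))) ≡ w u v * ι (len u v)
      pointwise u v = trans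
        (sum-cong-≗ λ k → trans (eq (𝟙 (active? k)) (w u v) (𝟙 (side? u v k)))
          (cong (w u v *_) (sym (𝟙-× (active? k) (side? u v k)))))
        (trans (sym (*-distribˡ-sum (w u v) (λ k → 𝟙 (between? u v k))))
          (cong (w u v *_) (sym (ι-∣subset∣ (between? u v)))))

    -- Raising p to ½ + ε on an initial segment and lowering it to ½ - ε
    -- elsewhere gains ε on each crossing arc, up to a second-order loss.
    tilt : ∀ {ε} → 0ℚ ≤ ε → ε ≤ ½ → ∀ k → ε * crossing-weight k ≤ σ + ε * ε * W
    tilt {ε} 0≤ε ε≤½ k = ≤-cert (≤⇒0≤ (≤-trans E≥ (<⇒≤ (small p prob))))
      (eq σ (ε * crossing-weight k) (ε * ε) W)
      where
      eq : ∀ σ x e W → σ + e * W ≡ x + (¼ * W + σ - ((¼ - e) * W + x))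
      eq = solve-∀ ring

      up? : ∀ v → Dec (key v ℕ.≤ key k)
      up? v = key v ℕ.≤? key k

      tilted : ∀ {v} → Dec (key v ℕ.≤ key k) → ℚ
      tilted (yes _) = ½ + ε
      tilted (no _)  = ½ - ε

      p : Fin n → ℚ
      p v = tilted (up? v)

      0≤½-ε : 0ℚ ≤ ½ - ε
      0≤½-ε = ≤⇒0≤ ε≤½

      prob′ : ∀ {v} (d : Dec (key v ℕ.≤ key k)) → IsProbability (tilted d)
      prob′ (yes _) = (0≤½ ⊞ 0≤ε) , +-monoʳ-≤ ½ ε≤½
      prob′ (no _)  = 0≤½-ε , ≤-cert (0≤½ ⊞ 0≤ε) (eq₁ ε)
        where
        eq₁ : ∀ ε → 1ℚ ≡ ½ - ε + (½ + ε)
        eq₁ = solve-∀ ring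

      prob : ∀ v → IsProbability (p v)
      prob v = prob′ (up? v)

      -- An arc within one segment has factor exactly `¼ - ε²`, a crossing arc has `(½ + ε)²`, and
      -- the order of the keys excludes arcs crossing backwards.
      arc-bound : ∀ {u v} → IsArc u v → (d : Dec (key u ℕ.≤ key k)) (e : Dec (key v ℕ.≤ key k))
                  (s : Dec (Side u v k)) →
                  (¼ - ε * ε) * w u v + ε * (w u v * 𝟙 s) ≤ w u v * (tilted d * (1ℚ - tilted e))
      arc-bound {u} {v} (_ , u<v) (yes u≤k) (no v≰k) s = ≤-cert
        (0≤w u v ⊠ (0≤ε ⊠ (≤⇒0≤ (𝟙≤1 s)) ⊞ (0≤ε ⊠ 0≤ε ⊞ 0≤ε ⊠ 0≤ε))) (eq₁ (w u v) ε (𝟙 s))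
        where
        eq₁ : ∀ w ε s → w * ((½ + ε) * (1ℚ - (½ - ε))) ≡
              (¼ - ε * ε) * w + ε * (w * s) + w * (ε * (1ℚ - s) + (ε * ε + ε * ε))
        eq₁ = solve-∀ ring
      arc-bound {u} {v} _ (yes _) (yes v≤k) s = ≤-reflexive (trans
        (cong (λ x → (¼ - ε * ε) * w u v + ε * (w u v * x)) (𝟙-no s λ (_ , k<v) → ℕ.<⇒≱ k<v v≤k))
        (eq₁ (w u v) ε))
        where
        eq₁ : ∀ w ε → (¼ - ε * ε) * w + ε * (w * 0ℚ) ≡ w * ((½ + ε) * (1ℚ - (½ + ε)))
        eq₁ = solve-∀ ring
      arc-bound {u} {v} _ (no u≰k) (no _) s = ≤-reflexive (trans
        (cong (λ x → (¼ - ε * ε) * w u v + ε * (w u v * x)) (𝟙-no s λ (u≤k , _) → u≰k u≤k))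
        (eq₁ (w u v) ε))
        where
        eq₁ : ∀ w ε → (¼ - ε * ε) * w + ε * (w * 0ℚ) ≡ w * ((½ - ε) * (1ℚ - (½ - ε)))
        eq₁ = solve-∀ ring
      arc-bound (_ , u<v) (no u≰k) (yes v≤k) _ = ⊥-elim (u≰k (ℕ.≤-trans (ℕ.<⇒≤ u<v) v≤k))

      pointwise : ∀ u v → (¼ - ε * ε) * w u v + ε * (w u v * 𝟙 (side? u v k)) ≤ w u v * (p u * (1ℚ - p v))
      pointwise u v with arc⊎0 u v
      ... | inj₁ uv  = arc-bound uv (up? u) (up? v) (side? u v k)
      ... | inj₂ w≡0 = ≤-reflexive (trans
        (cong₂ _+_ (q≡0⇒p*q≡0 (¼ - ε * ε) w≡0) (q≡0⇒p*q≡0 ε (p≡0⇒p*q≡0 (𝟙 (side? u v k)) w≡0)))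
        (sym (p≡0⇒p*q≡0 (p u * (1ℚ - p v)) w≡0)))

      E≥ : (¼ - ε * ε) * W + ε * crossing-weight k ≤ E p
      E≥ = subst (_≤ E p)
        (trans (sum₂-+ (λ u v → (¼ - ε * ε) * w u v) (λ u v → ε * (w u v * 𝟙 (side? u v k))))
          (sym (cong₂ _+_ (*-distribˡ-sum₂ (¼ - ε * ε) w)
            (*-distribˡ-sum₂ ε (λ u v → w u v * 𝟙 (side? u v k))))))
        (sum₂-mono-≤ pointwise)

    -- By `Z≡` only active `k` enter the sum, and there are at most `12 σ` of them.
    actives-bound : ∀ {c x} → 0ℚ ≤ c → 0ℚ ≤ x → (∀ k → c * crossing-weight k ≤ x) → c * Z ≤ 12ℚ * σ * x
    actives-bound {c} {x} 0≤c 0≤x bound = ≤-trans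
      (subst₂ _≤_
        (sym (trans (cong (c *_) Z≡) (*-distribˡ-sum c (λ k → 𝟙 (active? k) * crossing-weight k))))
        (sym (*-distribʳ-sum x (λ k → 𝟙 (active? k))))
        (sum-mono-≤ λ k → ≤-cert (0≤𝟙 (active? k) ⊠ ≤⇒0≤ (bound k)) (eq c (𝟙 (active? k)) (crossing-weight k) x)))
      (*-monoʳ-≤-nonNeg x {{nonNegative 0≤x}} actives≤12σ)
      where
      eq : ∀ c a y x → a * x ≡ c * (a * y) + a * (x - c * y)
      eq = solve-∀ ring

    tilt-Z : ∀ {ε} → 0ℚ ≤ ε → ε ≤ ½ → ε * Z ≤ 12ℚ * σ * (σ + ε * ε * W)
    tilt-Z {ε} 0≤ε ε≤½ = actives-bound 0≤ε (<⇒≤ 0<σ ⊞ 0≤ε ⊠ 0≤ε ⊠ 0≤sum₂ 0≤w) (tilt 0≤ε ε≤½)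

    Z≤12σW : Z ≤ 12ℚ * σ * W
    Z≤12σW = subst (_≤ 12ℚ * σ * W) (*-identityˡ Z)
      (actives-bound 0≤1 (0≤sum₂ 0≤w) λ k → subst (_≤ W) (sym (*-identityˡ (crossing-weight k))) (crossing-weight≤W k))

    -- `short` climbs from zero at `0` to `W` at `n`, so it passes half of `W`.
    weighted-median : 0ℚ < W → ∃[ L ] (short L ≤ ½ * W × ¬ short (suc L) ≤ ½ * W)
    weighted-median 0<W = crossing {P = λ L → short L ≤ ½ * W} (λ L → short L ≤? ½ * W)
      (≤-trans short-zero (0≤½ ⊠ <⇒≤ 0<W)) {n}
      (λ all≤½W → <-irrefl refl (<-≤-trans (½x<x 0<W) (subst (_≤ ½ * W) short-all all≤½W)))

    W²≤64σZ : 0ℚ < W → W * W ≤ 64ℚ * σ * Z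
    W²≤64σZ 0<W = let (L , short≤½W , short≰½W) = weighted-median 0<W in
      median-arithmetic (<⇒≤ 0<W) (<⇒≤ 0<σ) (0≤ι (suc L)) short≤½W
        (≤-trans (<⇒≤ (≰⇒> short≰½W)) (short≤ (suc L))) (long≤Z L)

    -- Comparing the cube of the weight with a fifth power

    τ : ℚ
    τ = 12ℚ * σ

    0<τ : 0ℚ < τ
    0<τ = 0<* (positive⁻¹ 12ℚ) 0<σ

    0≤Z : 0ℚ ≤ Z
    0≤Z = 0≤sum₂ λ u v → 0≤w u v ⊠ 0≤ι (len u v)

    -- To fit `tilt-arithmetic`, constants are rounded up: `64 σ` to `6 τ = 72 σ`, and `σ` to `⅛ τ`,
    -- which is `3 σ / 2`.
    W³≤18τ⁵ : 0ℚ < W → W * W * W ≤ 18ℚ * (τ * τ * τ * τ * τ)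
    W³≤18τ⁵ 0<W = tilt-arithmetic 0<W 0<τ
      (≤-trans (W²≤64σZ 0<W) (weaken₁ (<⇒≤ 0<σ) 0≤Z)) Z≤12σW
      λ ε 0≤ε ε≤½ → ≤-trans (tilt-Z 0≤ε ε≤½) (weaken₂ {e = ε * ε * W} (<⇒≤ 0<σ))
      where
      8* : ∀ {x} → 0ℚ ≤ x → 0ℚ ≤ (4ℚ + 4ℚ) * x
      8* = nonNegative⁻¹ (4ℚ + 4ℚ) ⊠_

      weaken₁ : ∀ {s z} → 0ℚ ≤ s → 0ℚ ≤ z → 64ℚ * s * z ≤ 6ℚ * (12ℚ * s) * z
      weaken₁ {s} {z} 0≤s 0≤z = ≤-cert (8* (0≤s ⊠ 0≤z)) (eq s z)
        where
        eq : ∀ s z → 6ℚ * (12ℚ * s) * z ≡ 64ℚ * s * z + (4ℚ + 4ℚ) * (s * z)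
        eq = solve-∀ ring

      weaken₂ : ∀ {s e} → 0ℚ ≤ s → 12ℚ * s * (s + e) ≤ 12ℚ * s * (⅛ * (12ℚ * s) + e)
      weaken₂ {s} {e} 0≤s = ≤-cert (nonNegative⁻¹ 6ℚ ⊠ (0≤s ⊠ 0≤s)) (eq s e)
        where
        eq : ∀ s e → 12ℚ * s * (⅛ * (12ℚ * s) + e) ≡ 12ℚ * s * (s + e) + 6ℚ * (s * s)
        eq = solve-∀ ring

    0<τ⁵ : 0ℚ < τ * τ * τ * τ * τ
    0<τ⁵ = 0<* (0<* (0<* (0<* 0<τ 0<τ) 0<τ) 0<τ) 0<τ

    -- The factor is `2⁵`: for `σ = s / 24`, `τ` is `s / 2` and the right side is `s⁵`. If `W` is
    -- zero, positivity of `τ` suffices.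
    W³<32τ⁵ : W * W * W < 32ℚ * (τ * τ * τ * τ * τ)
    W³<32τ⁵ = case 0ℚ <? W of λ
      { (yes 0<W) → ≤-<-trans (W³≤18τ⁵ 0<W)
          (*-monoˡ-<-pos (τ * τ * τ * τ * τ) {{positive 0<τ⁵}} (Dec.from-yes (18ℚ <? 32ℚ)))
      ; (no 0≮W) → ≤-<-trans
          (≤-reflexive (cong (λ x → x * x * x) (≤-antisym (≮⇒≥ 0≮W) (0≤sum₂ 0≤w))))
          (0<* (positive⁻¹ 32ℚ) 0<τ⁵) }

  -- Large cuts for rational weights

  module RationalWeights {n : ℕ} (w : Fin n → Fin n → ℚ) (key : Fin n → ℕ)
    (arc⊎0 : ∀ u v → (1ℚ ≤ w u v × key u ℕ.< key v) ⊎ w u v ≡ 0ℚ)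
    (key-injective : ∀ {u v} → key u ≡ key v → u ≡ v)
    where
    open Cut w
    open ArcWeights w key arc⊎0

    1/24 : ℚ
    1/24 = ℤ.+ 1 / 24

    -- A rational `p + r` below the claimed bound: `p` comes from the quarter of the weight, `r`
    -- from the power term, and `s` is at most the `3/5` power of `t`.
    module _ {p r s t : ℚ} (4p≤W : p * 4ℚ ≤ W) (24r<s : r * 24ℚ < s)
      (0≤t : 0ℚ ≤ t) (t≤W : t ≤ W) (s⁵≤t³ : s ℝ.^ 5 ≤ t ℝ.^ 3) where

      p+r<¼W+s/24 : p + r < ¼ * W + s * 1/24
      p+r<¼W+s/24 = +-mono-≤-< {p} (≤-cert (0≤¼ ⊠ ≤⇒0≤ 4p≤W) (eq₁ p W))
        (subst (_< s * 1/24) (eq₂ r) (*-monoˡ-<-pos 1/24 24r<s))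
        where
        eq₁ : ∀ p W → ¼ * W ≡ p + ¼ * (W - p * 4ℚ)
        eq₁ = solve-∀ ring
        eq₂ : ∀ r → r * 24ℚ * 1/24 ≡ r
        eq₂ r = trans (*-assoc r 24ℚ 1/24) (*-identityʳ r)

      t³≤W³ : t ℝ.^ 3 ≤ W * W * W
      t³≤W³ = ≤-cert (≤⇒0≤ t≤W ⊠ (0≤W ⊠ 0≤W ⊞ 0≤W ⊠ 0≤t ⊞ 0≤t ⊠ 0≤t)) (eq W t)
        where
        0≤W : 0ℚ ≤ W
        0≤W = ≤-trans 0≤t t≤W

        eq : ∀ W t → W * W * W ≡ t * (t * (t * 1ℚ)) + (W - t) * (W * W + W * t + t * t)
        eq = solve-∀ ring

      -- If no cut exceeds p + r, then by rounding no fractional cut does.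
      not-all-small : ¬ (∀ X → E (indicator X) ≤ p + r)
      not-all-small all-small =
        <-irrefl refl (<-≤-trans (subst (W * W * W <_) (eq s) W³<32τ⁵) (≤-trans s⁵≤t³ t³≤W³))
        where
        small : ∀ x → (∀ v → IsProbability (x v)) → E x < ¼ * W + s * 1/24
        small x prob = let (X , up) = rounding w loopless x prob in
          ≤-<-trans (≤-trans up (all-small X)) p+r<¼W+s/24

        open SmallCuts w key arc⊎0 (s * 1/24) small key-injective using (W³<32τ⁵)

        eq : ∀ s → 32ℚ * (12ℚ * (s * 1/24) * (12ℚ * (s * 1/24)) * (12ℚ * (s * 1/24))
             * (12ℚ * (s * 1/24)) * (12ℚ * (s * 1/24))) ≡ s * (s * (s * (s * (s * 1ℚ))))
        eq = solve-∀ ring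

      -- There are finitely many subsets and the comparison is decidable, so a search turns the
      -- refutation into an actual cut.
      large-cut : ∃[ X ] p + r < E (indicator X)
      large-cut with Subset.anySubset? (λ X → p + r <? E (indicator X))
      ... | yes cut = cut
      ... | no ∄cut = ⊥-elim (not-all-small λ X → ≮⇒≥ λ lt → ∄cut (X , lt))

  -- Topological order

  lookup-injective : ∀ {A : Set} {vs : List A} → Unique vs → Injective _≡_ _≡_ (List.lookup vs)
  lookup-injective (_  ∷ _)      {zero}  {zero}  _  = refl
  lookup-injective (v∉ ∷ _)      {zero}  {suc j} eq = ⊥-elim (All.lookup v∉ (∈-lookup j) eq)
  lookup-injective (v∉ ∷ _)      {suc i} {zero}  eq = ⊥-elim (All.lookup v∉ (∈-lookup i) (sym eq))
  lookup-injective (_  ∷ unique) {suc i} {suc j} eq = cong suc (lookup-injective unique eq)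

  unique-length≤ : ∀ {n} {vs : List (Fin n)} → Unique vs → length vs ℕ.≤ n
  unique-length≤ unique = Fin.injective⇒≤ (lookup-injective unique)

  module _ {A : Set} {R : A → A → Set} where

    linked-prefix : ∀ ys {u zs} → Linked R (ys ++ u ∷ zs) → Linked R (ys ++ [ u ])
    linked-prefix []           _        = [-]
    linked-prefix (y ∷ [])     (r ∷ _)  = r ∷ [-]
    linked-prefix (y ∷ z ∷ ys) (r ∷ rs) = r ∷ linked-prefix (z ∷ ys) rs

    -- The path from `v` is cut off where it meets `u`; the arc from `u` to `v` closes it.
    linked-closing : ∀ {u v p} ys {zs} → v ∷ p ≡ ys ++ u ∷ zs → R u v → Linked R (v ∷ p) →
                     Linked R (u ∷ ys ++ [ u ])
    linked-closing []       refl r _  = r ∷ [-]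
    linked-closing (y ∷ ys) refl r rs = r ∷ linked-prefix (y ∷ ys) rs

  unique-rotate : ∀ {A : Set} ys {u : A} {zs} → Unique (ys ++ u ∷ zs) → Unique (u ∷ ys)
  unique-rotate []       _             = [] ∷ []
  unique-rotate (y ∷ ys) (y∉ ∷ unique) with unique-rotate ys unique
  ... | u∉ ∷ unique′ = ((All.lookup y∉ (∈-++⁺ʳ ys (here refl)) ∘ sym) ∷ u∉) ∷ (All.++⁻ˡ ys y∉ ∷ unique′)

  sumℕ : ∀ {n} → (Fin n → ℕ) → ℕ
  sumℕ = Vector.foldr ℕ._+_ 0

  sumℕ-cong : ∀ {n} {f g : Fin n → ℕ} → (∀ i → f i ≡ g i) → sumℕ f ≡ sumℕ g
  sumℕ-cong {zero}  f≗g = refl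
  sumℕ-cong {suc _} f≗g = cong₂ ℕ._+_ (f≗g zero) (sumℕ-cong (f≗g ∘ suc))

  f≤sumℕ : ∀ {n} (f : Fin n → ℕ) k → f k ℕ.≤ sumℕ f
  f≤sumℕ f zero    = ℕ.m≤m+n (f zero) _
  f≤sumℕ f (suc k) = ℕ.≤-trans (f≤sumℕ (f ∘ suc) k) (ℕ.m≤n+m _ (f zero))

  ifTℕ : (b : Bool) → (T b → ℕ) → ℕ
  ifTℕ true  f = f _
  ifTℕ false f = 0

  ifTℕ-cong : ∀ b {f g : T b → ℕ} → (∀ t → f t ≡ g t) → ifTℕ b f ≡ ifTℕ b g
  ifTℕ-cong true  f≗g = f≗g _
  ifTℕ-cong false f≗g = refl

  f≤ifTℕ : ∀ b (f : T b → ℕ) t → f t ℕ.≤ ifTℕ b f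
  f≤ifTℕ true f _ = ℕ.≤-refl

  module TopologicalOrder {n} (D : ℝ.WeightedDigraph n) (acyclic : ℝ.Acyclic D) where
    open ℝ.WeightedDigraph D using (arc; Arc)
    open DecMembership (Fin._≟_ {n}) using (_∈?_)

    -- A path grown backwards from v closes a cycle or has at most n vertices.
    accessible : ∀ fuel v p → Unique (v ∷ p) → Linked Arc (v ∷ p) → n ℕ.< fuel ℕ.+ length (v ∷ p) → Acc Arc v
    accessible zero       v p unique _      n< = ⊥-elim (ℕ.<⇒≱ n< (unique-length≤ unique))
    accessible (suc fuel) v p unique linked n< = acc predecessor
      where
      predecessor : ∀ {u} → Arc u v → Acc Arc u
      predecessor {u} uv with u ∈? (v ∷ p)
      ... | no u∉ = accessible fuel u (v ∷ p) (All.¬Any⇒All¬ (v ∷ p) u∉ ∷ unique) (uv ∷ linked)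
        (subst (n ℕ.<_) (sym (ℕ.+-suc fuel (length (v ∷ p)))) n<)
      ... | yes u∈ with ys , zs , eq ← ∈-∃++ u∈ = ⊥-elim (acyclic record
        { base     = u
        ; others   = ys
        ; distinct = unique-rotate ys (subst Unique eq unique)
        ; linked   = linked-closing ys eq uv linked })

    -- A sum in place of the usual maximum over predecessors: it dominates each of its terms, hence
    -- grows strictly along arcs.
    height : ∀ {v} → Acc Arc v → ℕ
    height {v} (acc rs) = sumℕ λ u → ifTℕ (arc u v) λ a → suc (height (rs a))

    -- A vertex may be reached with different accessibility proofs, and `height-<` has to compare
    -- their heights.
    height-irrelevant : ∀ {v} (a b : Acc Arc v) → height a ≡ height b
    height-irrelevant {v} (acc rs) (acc qs) = sumℕ-cong λ u →
      ifTℕ-cong (arc u v) λ a → cong suc (height-irrelevant (rs a) (qs a))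

    height-< : ∀ {u v} (a : Acc Arc u) (b : Acc Arc v) → Arc u v → height a ℕ.< height b
    height-< {u} {v} a (acc rs) uv = ℕ.≤-trans
      (subst (λ m → suc m ℕ.≤ ifTℕ (arc u v) λ e → suc (height (rs e))) (height-irrelevant (rs uv) a)
        (f≤ifTℕ (arc u v) (λ e → suc (height (rs e))) uv))
      (f≤sumℕ (λ u → ifTℕ (arc u v) λ e → suc (height (rs e))) u)

    arc-wellFounded : WellFounded Arc
    arc-wellFounded v = accessible n v [] ([] ∷ []) [-] (ℕ.≤-reflexive (ℕ.+-comm 1 n))

    rank : Fin n → ℕ
    rank v = height (arc-wellFounded v)

    -- Ties in rank are broken by the numbering of the vertices.
    key : Fin n → ℕ
    key v = rank v ℕ.* n ℕ.+ toℕ v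

    key-mono-< : ∀ {u v} → rank u ℕ.< rank v → key u ℕ.< key v
    key-mono-< {u} {v} ru<rv = begin-strict
      rank u ℕ.* n ℕ.+ toℕ u <⟨ ℕ.+-monoʳ-< (rank u ℕ.* n) (Fin.toℕ<n u) ⟩
      rank u ℕ.* n ℕ.+ n     ≡⟨ ℕ.+-comm (rank u ℕ.* n) n ⟩
      suc (rank u) ℕ.* n     ≤⟨ ℕ.*-monoˡ-≤ n ru<rv ⟩
      rank v ℕ.* n           ≤⟨ ℕ.m≤m+n (rank v ℕ.* n) (toℕ v) ⟩
      key v                  ∎
      where open ℕ.≤-Reasoning

    arc⇒key< : ∀ {u v} → Arc u v → key u ℕ.< key v
    arc⇒key< {u} {v} uv = key-mono-< (height-< (arc-wellFounded u) (arc-wellFounded v) uv)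

    key-injective : ∀ {u v} → key u ≡ key v → u ≡ v
    key-injective {u} {v} eq with ℕ.<-cmp (rank u) (rank v)
    ... | tri< ru<rv _ _ = ⊥-elim (ℕ.<-irrefl eq (key-mono-< ru<rv))
    ... | tri≈ _ ru≡rv _ = Fin.toℕ-injective (ℕ.+-cancelˡ-≡ (rank u ℕ.* n) (toℕ u) (toℕ v)
      (trans eq (cong (λ r → r ℕ.* n ℕ.+ toℕ v) (sym ru≡rv))))
    ... | tri> _ _ rv<ru = ⊥-elim (ℕ.<-irrefl (sym eq) (key-mono-< rv<ru))

  -- Rational lower bounds of reals

  -- Unlike membership in the cut, this allows `q` to equal the real: a weight of exactly one is
  -- still bounded below by `1ℚ`.
  Below : ℚ → ℝ.ℝ → Set
  Below q x = ℝ.fromℚ q ℝ.≤ x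

  ∈⇒Below : ∀ x {q} → q ℝ.∈ x → Below q x
  ∈⇒Below x q∈x p<q = ℝ.closed x p<q q∈x

  Below-⊔ : ∀ x {p q} → Below p x → Below q x → Below (p ⊔ q) x
  Below-⊔ x {p} {q} p≤x q≤x = [ (λ eq → subst (λ r → Below r x) (sym eq) p≤x)
                              , (λ eq → subst (λ r → Below r x) (sym eq) q≤x) ]′ (⊔-sel p q)

  p<q+r⇒p-r<q : ∀ {p q r} → p < q + r → p - r < q
  p<q+r⇒p-r<q {p} {q} {r} p<q+r = subst (p - r <_) (eq q r) (+-monoˡ-< (- r) p<q+r)
    where
    eq : ∀ q r → q + r - r ≡ q
    eq = solve-∀ ring

  Below-+ : ∀ x y {p q} → Below p x → Below q y → Below (p + q) (x ℝ.+ y)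
  Below-+ x y {p} {q} p≤x q≤y {s} s<p+q =
    -- Any `m` strictly between `s - q` and `p` splits `s` into `m` below `p` and `s - m` below `q`.
    let (m , s-q<m , m<p) = <-dense (p<q+r⇒p-r<q s<p+q) in
    m , s - m , p≤x m<p , q≤y (p<q+r⇒p-r<q (s<q+m s-q<m)) , eq₁ m s
    where
    eq₁ : ∀ m s → s ≡ m + (s - m)
    eq₁ = solve-∀ ring
    eq₂ : ∀ s q → s - q + q ≡ s
    eq₂ = solve-∀ ring

    s<q+m : ∀ {m} → s - q < m → s < q + m
    s<q+m {m} s-q<m = subst₂ _<_ (eq₂ s q) (+-comm m q) (+-monoˡ-< q s-q<m)

  Below-∑ : ∀ {n} {a : Fin n → ℚ} (f : Fin n → ℝ.ℝ) → (∀ i → Below (a i) (f i)) → Below (sum a) (ℝ.∑ f)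
  Below-∑ {zero}  f a≤f = λ q<0 → q<0
  Below-∑ {suc _} f a≤f = Below-+ (f zero) (ℝ.∑ (f ∘ suc)) (a≤f zero) (Below-∑ (f ∘ suc) (a≤f ∘ suc))

  ∑-approx : ∀ {n} (f : Fin n → ℝ.ℝ) {p} → p ℝ.∈ ℝ.∑ f →
             ∃[ a ] ((∀ i → a i ℝ.∈ f i) × p ≤ sum a)
  ∑-approx {zero}  f p<0 = (λ ()) , (λ ()) , <⇒≤ p<0
  ∑-approx {suc n} f (p , r , p∈ , r∈ , refl) with a , a∈ , r≤ ← ∑-approx (f ∘ suc) r∈ =
    b , b∈ , +-monoʳ-≤ p r≤
    where
    b : Fin (suc n) → ℚ
    b zero    = p
    b (suc i) = a i

    b∈ : ∀ i → b i ℝ.∈ f i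
    b∈ zero    = p∈
    b∈ (suc i) = a∈ i

  ∑₂-approx : ∀ {m n} (f : Fin m → Fin n → ℝ.ℝ) {p} → p ℝ.∈ ℝ.∑ (λ u → ℝ.∑ (f u)) →
              ∃[ a ] ((∀ u v → a u v ℝ.∈ f u v) × p ≤ sum₂ a)
  ∑₂-approx f p∈ with b , b∈ , p≤ ← ∑-approx (λ u → ℝ.∑ (f u)) p∈ =
      (λ u → proj₁ (rows u)) , (λ u → proj₁ (proj₂ (rows u)))
    , ≤-trans p≤ (sum-mono-≤ λ u → proj₂ (proj₂ (rows u)))
    where
    rows : ∀ u → ∃[ a ] ((∀ v → a v ℝ.∈ f u v) × b u ≤ sum a)
    rows u = ∑-approx (f u) (b∈ u)

  ∈-maxSubset : ∀ {n} (f : Subset n → ℝ.ℝ) X → f X ℝ.≤ ℝ.maxSubset f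
  ∈-maxSubset f []            q∈ = q∈
  ∈-maxSubset f (outside ∷ X) q∈ = inj₁ (∈-maxSubset (λ S → f (outside ∷ S)) X q∈)
  ∈-maxSubset f (inside ∷ X)  q∈ = inj₂ (∈-maxSubset (λ S → f (inside ∷ S)) X q∈)

  -- Rational weights

  -- Two lower bounds are dominated at once, because the linear term and the power term of the claim
  -- each bring their own approximation of the weights.
  record Approximation (b : Bool) (f : T b → ℝ.ℝ) (p q : ℚ) : Set where
    field
      value : ℚ
      p≤    : p ≤ value
      q≤    : q ≤ value
      below : Below value (ℝ.ifT b f)
      arc⊎0 : (1ℚ ≤ value × T b) ⊎ value ≡ 0ℚ

  -- On an arc, the maximum with `1ℚ` restores the bound that members of the cut may violate;
  -- elsewhere `0ℚ` exceeds both `p` and `q`.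
  approximate : ∀ b (f : T b → ℝ.ℝ) → (∀ t → ℝ.1ℝ ℝ.≤ f t) → ∀ {p q} →
                p ℝ.∈ ℝ.ifT b f → q ℝ.∈ ℝ.ifT b f → Approximation b f p q
  approximate false f _ p<0 q<0 = record
    { value = 0ℚ ; p≤ = <⇒≤ p<0 ; q≤ = <⇒≤ q<0 ; below = λ r<0 → r<0 ; arc⊎0 = inj₂ refl }
  approximate true f 1≤f {p} {q} p∈ q∈ = record
    { value = 1ℚ ⊔ (p ⊔ q)
    ; p≤    = ≤-trans (p≤p⊔q p q) (p≤q⊔p 1ℚ (p ⊔ q))
    ; q≤    = ≤-trans (p≤q⊔p p q) (p≤q⊔p 1ℚ (p ⊔ q))
    ; below = Below-⊔ (f _) (1≤f _) (Below-⊔ (f _) (∈⇒Below (f _) p∈) (∈⇒Below (f _) q∈))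
    ; arc⊎0 = inj₁ (p≤p⊔q 1ℚ (p ⊔ q) , _) }

  -- Transfer of the bound to real weights

  module MaximumCut {n} (D : ℝ.WeightedDigraph n) (acyclic : ℝ.Acyclic D)
    (1≤weight : ∀ u v (a : ℝ.Arc D u v) → ℝ.1ℝ ℝ.≤ ℝ.weight D u v a) where
    open ℝ.WeightedDigraph D using (arc; weight)
    open TopologicalOrder D acyclic using (key; arc⇒key<; key-injective)

    module _ (a c : Fin n → Fin n → ℚ)
      (a∈ : ∀ u v → a u v ℝ.∈ ℝ.pairWeight D u v) (c∈ : ∀ u v → c u v ℝ.∈ ℝ.pairWeight D u v) where

      approximation : ∀ u v → Approximation (arc u v) (weight u v) (a u v) (c u v)
      approximation u v = approximate (arc u v) (weight u v) (1≤weight u v) (a∈ u v) (c∈ u v)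

      w : Fin n → Fin n → ℚ
      w u v = Approximation.value (approximation u v)

      arc⊎0 : ∀ u v → (1ℚ ≤ w u v × key u ℕ.< key v) ⊎ w u v ≡ 0ℚ
      arc⊎0 u v with Approximation.arc⊎0 (approximation u v)
      ... | inj₁ (1≤w , uv) = inj₁ (1≤w , arc⇒key< uv)
      ... | inj₂ w≡0        = inj₂ w≡0

      open Cut w

      below-weightBetween : ∀ X → Below (E (indicator X)) (ℝ.weightBetween D X (∁ X))
      below-weightBetween X = Below-∑ _ λ u → Below-∑ _ λ v → pointwise u v
        where
        x*0≡0 : ∀ w x → w * (x * 0ℚ) ≡ 0ℚ
        x*0≡0 = solve-∀ ring
        x*1≡x : ∀ w → w * 1ℚ ≡ w
        x*1≡x = solve-∀ ring

        cell : ∀ b c {d w} x → d ≡ not c → Below w x →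
               Below (w * ((if b then 1ℚ else 0ℚ) * (1ℚ - (if c then 1ℚ else 0ℚ))))
                     (ℝ.ifT (b ∧ d) λ _ → x)
        cell true  false {w = w} x refl w≤x = subst (λ y → Below y x) (sym (x*1≡x w)) w≤x
        cell true  true  {w = w} x refl w≤x = subst (λ y → Below y ℝ.0ℝ) (sym (x*0≡0 w 1ℚ)) (λ q<0 → q<0)
        cell false true  {w = w} x refl w≤x = subst (λ y → Below y ℝ.0ℝ) (sym (x*0≡0 w 0ℚ)) (λ q<0 → q<0)
        cell false false {w = w} x refl w≤x = subst (λ y → Below y ℝ.0ℝ) (sym (*-zeroʳ w)) (λ q<0 → q<0)

        pointwise : ∀ u v → Below (w u v * (indicator X u * (1ℚ - indicator X v)))
          (ℝ.ifT (lookup X u ∧ lookup (∁ X) v) λ _ → ℝ.pairWeight D u v)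
        pointwise u v = cell (lookup X u) (lookup X v) (ℝ.pairWeight D u v) (lookup-map v not X)
          (Approximation.below (approximation u v))

      p+r∈mac : ∀ {p r s t} → p * 4ℚ ≤ W → r * 24ℚ < s → 0ℚ ≤ t → t ≤ W → s ℝ.^ 5 ≤ t ℝ.^ 3 →
                p + r ℝ.∈ ℝ.mac D
      p+r∈mac {p} {r} {s} {t} 4p≤W 24r<s 0≤t t≤W s⁵≤t³ =
        let (X , p+r<cut) = RationalWeights.large-cut w key arc⊎0 key-injective
              {p} {r} {s} {t} 4p≤W 24r<s 0≤t t≤W s⁵≤t³
        in ∈-maxSubset (λ X → ℝ.weightBetween D X (∁ X)) X (below-weightBetween X p+r<cut)

    bound : ℝ.totalWeight D ℝ.÷ 4ℚ ℝ.+ (ℝ.totalWeight D ℝ.^[ 3 / 5 ]) ℝ.÷ 24ℚ ℝ.≤ ℝ.mac D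
    bound (p , r , 4p∈ , power , refl) with ∑₂-approx (ℝ.pairWeight D) 4p∈ | power
    -- For negative `r` in the power term, `s = t = 0` serves, and `a` takes both places.
    ... | a , a∈ , 4p≤ | inj₁ 24r<0 = p+r∈mac a a a∈ a∈ {p} {r} {0ℚ} {0ℚ}
      (≤-trans 4p≤ (sum₂-mono-≤ λ u v → Approximation.p≤ (approximation a a a∈ a∈ u v))) 24r<0 ≤-refl
      (0≤sum₂ (ArcWeights.0≤w (w a a a∈ a∈) key (arc⊎0 a a a∈ a∈))) ≤-refl
    ... | a , a∈ , 4p≤ | inj₂ (s , t , 24r<s , _ , 0≤t , t∈ , s⁵≤t³)
      with c , c∈ , t≤ ← ∑₂-approx (ℝ.pairWeight D) t∈ = p+r∈mac a c a∈ c∈ {p} {r} {s} {t}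
      (≤-trans 4p≤ (sum₂-mono-≤ λ u v → Approximation.p≤ (approximation a c a∈ c∈ u v))) 24r<s 0≤t
      (≤-trans t≤ (sum₂-mono-≤ λ u v → Approximation.q≤ (approximation a c a∈ c∈ u v))) s⁵≤t³

open import Data.Nat.Base using (ℕ)
open import Data.Integer.Base using (+_)
open import Data.Rational.Base using (_/_)
open import Defs

mainTheorem12 : (n : ℕ) (D : WeightedDigraph n) → Acyclic D →
    (∀ u v (a : Arc D u v) → 1ℝ ≤ weight D u v a) →
    totalWeight D ÷ (+ 4 / 1) + (totalWeight D ^[ 3 / 5 ]) ÷ (+ 24 / 1) ≤ mac D
mainTheorem12 n D acyclic 1≤weight = FractionalCuts.MaximumCut.bound D acyclic 1≤weight
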